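{- For every integer $n \ge 1$, the Riemann zeta function satisfies $$\zeta(2n) = \frac{1}{2} \lim_{z \to 0} \left( U_{2n}(z) - \frac{1}{z^{2n}} \right), \qquad \text{where } U_{2n}(z) := \sum_{k \in \mathbb{Z}} \frac{1}{k^{2n} + z^{2n}}.$$
   Context: Here $z$ is a complex variable tending to $0$ through nonzero values; for $0<|z|<1$ all denominators $k^{2n}+z^{2n}$ are nonzero. -}

module Defs where

open import Algebra.Bundles using (RawSemiring)
open import Data.Integer.Base as ℤ using (ℤ)
open import Data.List.Base using (List; foldr; map)
open import Data.List.Relation.Binary.Subset.Propositional using (_⊆_)
open import Data.List.Relation.Unary.Unique.Propositional using (Unique)
open import Data.Nat.Base as ℕ using (ℕ; zero; suc)
import Data.Nat.Properties as ℕₚ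
open import Data.Product.Base using (Σ; ∃; _×_; _,_; proj₁; proj₂)
open import Data.Rational.Base as ℚ using (ℚ; 0ℚ; 1ℚ; ½)
import Data.Rational.Properties as ℚₚ
open import Data.Rational.Solver using (module +-*-Solver)
open import Data.Sum.Base using (inj₁; inj₂)
open import Level using (0ℓ)
open import Relation.Binary.PropositionalEquality
open import Relation.Nullary using (yes; no; contradiction)

open +-*-Solver using (solve; _:+_; _:*_; :-_; _:-_; _:=_)

private
  _∙<_ : ∀ {ε δ} → 0ℚ ℚ.< ε → 0ℚ ℚ.< δ → 0ℚ ℚ.< ε ℚ.* δ
  _∙<_ {ε} {δ} 0<ε 0<δ =
    subst (ℚ._< ε ℚ.* δ) (ℚₚ.*-zeroʳ ε)
      (ℚₚ.*-monoʳ-<-pos ε {{ℚ.positive 0<ε}} 0<δ)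

  0<½ : 0ℚ ℚ.< ½
  0<½ = ℚₚ.positive⁻¹ ½

  half+half : ∀ p → ½ ℚ.* p ℚ.+ ½ ℚ.* p ≡ p
  half+half p = trans (sym (ℚₚ.*-distribʳ-+ p ½ ½)) (ℚₚ.*-identityˡ p)

  *-mono-≤ : ∀ {a b c d} → 0ℚ ℚ.≤ c → 0ℚ ℚ.≤ b →
             a ℚ.≤ b → c ℚ.≤ d → a ℚ.* c ℚ.≤ b ℚ.* d
  *-mono-≤ {a} {b} {c} {d} 0≤c 0≤b a≤b c≤d = ℚₚ.≤-trans
    (ℚₚ.*-monoʳ-≤-nonNeg c {{ℚ.nonNegative 0≤c}} a≤b)
    (ℚₚ.*-monoˡ-≤-nonNeg b {{ℚ.nonNegative 0≤b}} c≤d)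

-- Total reciprocal, with invℚ 0 = 0.

invℚ : ℚ → ℚ
invℚ p with p ℚₚ.≟ 0ℚ
... | yes _  = 0ℚ
... | no p≢0 = ℚ.1/_ p {{ℚ.≢-nonZero p≢0}}

invℚ-inverseʳ : ∀ {p} → 0ℚ ℚ.< p → p ℚ.* invℚ p ≡ 1ℚ
invℚ-inverseʳ {p} 0<p with p ℚₚ.≟ 0ℚ
... | yes p≡0 = contradiction (sym p≡0) (ℚₚ.<⇒≢ 0<p)
... | no p≢0  = ℚₚ.*-inverseʳ p {{ℚ.≢-nonZero p≢0}}

invℚ-pos : ∀ {p} → 0ℚ ℚ.< p → 0ℚ ℚ.< invℚ p
invℚ-pos {p} 0<p = ℚₚ.*-cancelˡ-<-nonNeg p {{ℚ.nonNegative (ℚₚ.<⇒≤ 0<p)}}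
  (subst₂ ℚ._<_ (sym (ℚₚ.*-zeroʳ p)) (sym (invℚ-inverseʳ 0<p)) (ℚₚ.positive⁻¹ 1ℚ))

invℚ-anti : ∀ {p q} → 0ℚ ℚ.< p → p ℚ.≤ q → invℚ q ℚ.≤ invℚ p
invℚ-anti {p} {q} 0<p p≤q =
  ℚₚ.*-cancelˡ-≤-pos p {{ℚ.positive 0<p}} (begin
    p ℚ.* invℚ q  ≤⟨ ℚₚ.*-monoʳ-≤-nonNeg (invℚ q)
                       {{ℚ.nonNegative (ℚₚ.<⇒≤ (invℚ-pos 0<q))}} p≤q ⟩
    q ℚ.* invℚ q  ≡⟨ invℚ-inverseʳ 0<q ⟩
    1ℚ            ≡⟨ invℚ-inverseʳ 0<p ⟨
    p ℚ.* invℚ p  ∎)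
  where
  open ℚₚ.≤-Reasoning
  0<q = ℚₚ.<-≤-trans 0<p p≤q

-- Real numbers: Cauchy sequences of rationals.  Equality of reals is
-- the relation _≃ʳ_, not propositional equality.

IsCauchy : (ℕ → ℚ) → Set
IsCauchy x = ∀ ε → 0ℚ ℚ.< ε →
  ∃ λ N → ∀ m n → N ℕ.≤ m → N ℕ.≤ n → ℚ.∣ x m ℚ.- x n ∣ ℚ.< ε

record ℝ : Set where
  constructor mkℝ
  field
    seq    : ℕ → ℚ
    cauchy : IsCauchy seq

open ℝ public

infix 4 _≃ʳ_ _<ʳ_

_≃ʳ_ : ℝ → ℝ → Set
x ≃ʳ y = ∀ ε → 0ℚ ℚ.< ε →
  ∃ λ N → ∀ n → N ℕ.≤ n → ℚ.∣ seq x n ℚ.- seq y n ∣ ℚ.< ε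

-- Strict order demands a positive rational gap; a mere termwise
-- inequality seq x n < seq y n would only give x ≤ y.

_<ʳ_ : ℝ → ℝ → Set
x <ʳ y = ∃ λ ε → 0ℚ ℚ.< ε ×
  (∃ λ N → ∀ n → N ℕ.≤ n → seq x n ℚ.+ ε ℚ.≤ seq y n)

fromℚʳ : ℚ → ℝ
fromℚʳ p = mkℝ (λ _ → p) λ ε 0<ε →
  0 , λ _ _ _ _ → subst (λ d → ℚ.∣ d ∣ ℚ.< ε) (sym (ℚₚ.+-inverseʳ p)) 0<ε

infix  8 -ʳ_
infixl 7 _*ʳ_
infixl 6 _+ʳ_

_+ʳ_ : ℝ → ℝ → ℝ
x +ʳ y = mkℝ (λ n → seq x n ℚ.+ seq y n) λ ε 0<ε →
  let N₁ , h₁ = cauchy x (½ ℚ.* ε) (0<½ ∙< 0<ε)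
      N₂ , h₂ = cauchy y (½ ℚ.* ε) (0<½ ∙< 0<ε)
      open ℚₚ.≤-Reasoning
  in N₁ ℕ.⊔ N₂ , λ m n N≤m N≤n → begin-strict
    ℚ.∣ (seq x m ℚ.+ seq y m) ℚ.- (seq x n ℚ.+ seq y n) ∣
      ≡⟨ cong ℚ.∣_∣ (solve 4 (λ a b c d →
           (a :+ b) :- (c :+ d) := (a :- c) :+ (b :- d)) refl
           (seq x m) (seq y m) (seq x n) (seq y n)) ⟩
    ℚ.∣ (seq x m ℚ.- seq x n) ℚ.+ (seq y m ℚ.- seq y n) ∣
      ≤⟨ ℚₚ.∣p+q∣≤∣p∣+∣q∣ (seq x m ℚ.- seq x n) (seq y m ℚ.- seq y n) ⟩
    ℚ.∣ seq x m ℚ.- seq x n ∣ ℚ.+ ℚ.∣ seq y m ℚ.- seq y n ∣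
      <⟨ ℚₚ.+-mono-<
           (h₁ m n (ℕₚ.m⊔n≤o⇒m≤o N₁ N₂ N≤m) (ℕₚ.m⊔n≤o⇒m≤o N₁ N₂ N≤n))
           (h₂ m n (ℕₚ.m⊔n≤o⇒n≤o N₁ N₂ N≤m) (ℕₚ.m⊔n≤o⇒n≤o N₁ N₂ N≤n)) ⟩
    ½ ℚ.* ε ℚ.+ ½ ℚ.* ε
      ≡⟨ half+half ε ⟩
    ε ∎

-ʳ_ : ℝ → ℝ
-ʳ x = mkℝ (λ n → ℚ.- seq x n) λ ε 0<ε →
  let N , h = cauchy x ε 0<ε
  in N , λ m n N≤m N≤n → subst (ℚ._< ε)
       (trans (sym (ℚₚ.∣-p∣≡∣p∣ (seq x m ℚ.- seq x n)))
              (cong ℚ.∣_∣ (ℚₚ.neg-distrib-+ (seq x m) (ℚ.- seq x n))))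
       (h m n N≤m N≤n)

eventually-bounded : ∀ x → ∃ λ B → 0ℚ ℚ.< B ×
  (∃ λ N → ∀ n → N ℕ.≤ n → ℚ.∣ seq x n ∣ ℚ.≤ B)
eventually-bounded x =
  let N , h = cauchy x 1ℚ (ℚₚ.positive⁻¹ 1ℚ)
      xN    = seq x N
      open ℚₚ.≤-Reasoning
  in 1ℚ ℚ.+ ℚ.∣ xN ∣
   , ℚₚ.+-mono-<-≤ (ℚₚ.positive⁻¹ 1ℚ) (ℚₚ.0≤∣p∣ xN)
   , N
   , λ n N≤n → begin
       ℚ.∣ seq x n ∣                        ≡⟨ cong ℚ.∣_∣ (solve 2 (λ a b →
                                                 a := (a :- b) :+ b) refl (seq x n) xN) ⟩
       ℚ.∣ (seq x n ℚ.- xN) ℚ.+ xN ∣        ≤⟨ ℚₚ.∣p+q∣≤∣p∣+∣q∣ (seq x n ℚ.- xN) xN ⟩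
       ℚ.∣ seq x n ℚ.- xN ∣ ℚ.+ ℚ.∣ xN ∣    ≤⟨ ℚₚ.+-monoˡ-≤ ℚ.∣ xN ∣
                                                 (ℚₚ.<⇒≤ (h n N N≤n ℕₚ.≤-refl)) ⟩
       1ℚ ℚ.+ ℚ.∣ xN ∣                      ∎

_*ʳ_ : ℝ → ℝ → ℝ
x *ʳ y = mkℝ (λ n → seq x n ℚ.* seq y n) λ ε 0<ε →
  let A , 0<A , M₁ , a = eventually-bounded x
      B , 0<B , M₂ , b = eventually-bounded y
      C   = A ℚ.+ B
      0<C = ℚₚ.+-mono-< 0<A 0<B
      δ   = ε ℚ.* invℚ C
      N₁ , h₁ = cauchy x δ (0<ε ∙< invℚ-pos 0<C)
      N₂ , h₂ = cauchy y δ (0<ε ∙< invℚ-pos 0<C)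
      M   = M₁ ℕ.⊔ M₂
      N   = N₁ ℕ.⊔ N₂
      open ℚₚ.≤-Reasoning
  in M ℕ.⊔ N , λ m n l≤m l≤n →
    let M≤m  = ℕₚ.m⊔n≤o⇒m≤o M N l≤m
        M≤n  = ℕₚ.m⊔n≤o⇒m≤o M N l≤n
        N≤m  = ℕₚ.m⊔n≤o⇒n≤o M N l≤m
        N≤n  = ℕₚ.m⊔n≤o⇒n≤o M N l≤n
        xm = seq x m ; xn = seq x n ; ym = seq y m ; yn = seq y n
        ∣x-x∣<δ = h₁ m n (ℕₚ.m⊔n≤o⇒m≤o N₁ N₂ N≤m) (ℕₚ.m⊔n≤o⇒m≤o N₁ N₂ N≤n)
        ∣y-y∣<δ = h₂ m n (ℕₚ.m⊔n≤o⇒n≤o N₁ N₂ N≤m) (ℕₚ.m⊔n≤o⇒n≤o N₁ N₂ N≤n)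
    in begin-strict
      ℚ.∣ xm ℚ.* ym ℚ.- xn ℚ.* yn ∣
        ≡⟨ cong ℚ.∣_∣ (solve 4 (λ p q r s →
             p :* q :- r :* s := p :* (q :- s) :+ s :* (p :- r)) refl xm ym xn yn) ⟩
      ℚ.∣ xm ℚ.* (ym ℚ.- yn) ℚ.+ yn ℚ.* (xm ℚ.- xn) ∣
        ≤⟨ ℚₚ.∣p+q∣≤∣p∣+∣q∣ (xm ℚ.* (ym ℚ.- yn)) (yn ℚ.* (xm ℚ.- xn)) ⟩
      ℚ.∣ xm ℚ.* (ym ℚ.- yn) ∣ ℚ.+ ℚ.∣ yn ℚ.* (xm ℚ.- xn) ∣
        ≡⟨ cong₂ ℚ._+_ (ℚₚ.∣p*q∣≡∣p∣*∣q∣ xm (ym ℚ.- yn)) (ℚₚ.∣p*q∣≡∣p∣*∣q∣ yn (xm ℚ.- xn)) ⟩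
      ℚ.∣ xm ∣ ℚ.* ℚ.∣ ym ℚ.- yn ∣ ℚ.+ ℚ.∣ yn ∣ ℚ.* ℚ.∣ xm ℚ.- xn ∣
        ≤⟨ ℚₚ.+-mono-≤
             (ℚₚ.*-monoʳ-≤-nonNeg ℚ.∣ ym ℚ.- yn ∣ {{ℚₚ.∣-∣-nonNeg (ym ℚ.- yn)}}
               (a m (ℕₚ.m⊔n≤o⇒m≤o M₁ M₂ M≤m)))
             (ℚₚ.*-monoʳ-≤-nonNeg ℚ.∣ xm ℚ.- xn ∣ {{ℚₚ.∣-∣-nonNeg (xm ℚ.- xn)}}
               (b n (ℕₚ.m⊔n≤o⇒n≤o M₁ M₂ M≤n))) ⟩
      A ℚ.* ℚ.∣ ym ℚ.- yn ∣ ℚ.+ B ℚ.* ℚ.∣ xm ℚ.- xn ∣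
        <⟨ ℚₚ.+-mono-<
             (ℚₚ.*-monoʳ-<-pos A {{ℚ.positive 0<A}} ∣y-y∣<δ)
             (ℚₚ.*-monoʳ-<-pos B {{ℚ.positive 0<B}} ∣x-x∣<δ) ⟩
      A ℚ.* δ ℚ.+ B ℚ.* δ
        ≡⟨ solve 4 (λ p q e i → p :* (e :* i) :+ q :* (e :* i) := e :* ((p :+ q) :* i))
             refl A B ε (invℚ C) ⟩
      ε ℚ.* (C ℚ.* invℚ C)
        ≡⟨ trans (cong (ε ℚ.*_) (invℚ-inverseʳ 0<C)) (ℚₚ.*-identityʳ ε) ⟩
      ε ∎

-- Reciprocal of a positive real.  The finitely many terms at which
-- seq x may vanish do not affect the value.

recip⁺ : ∀ x → fromℚʳ 0ℚ <ʳ x → ℝ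
recip⁺ x (η , 0<η , M , gap) = mkℝ (λ n → invℚ (seq x n)) λ ε 0<ε →
  let i       = invℚ η
      δ       = ε ℚ.* (η ℚ.* η)
      N , h   = cauchy x δ (0<ε ∙< (0<η ∙< 0<η))
      open ℚₚ.≤-Reasoning
  in M ℕ.⊔ N , λ m n l≤m l≤n →
    let u = seq x m ; v = seq x n ; u⁻¹ = invℚ u ; v⁻¹ = invℚ v
        η≤u = subst (ℚ._≤ u) (ℚₚ.+-identityˡ η) (gap m (ℕₚ.m⊔n≤o⇒m≤o M N l≤m))
        η≤v = subst (ℚ._≤ v) (ℚₚ.+-identityˡ η) (gap n (ℕₚ.m⊔n≤o⇒m≤o M N l≤n))
        0<u = ℚₚ.<-≤-trans 0<η η≤u
        0<v = ℚₚ.<-≤-trans 0<η η≤v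
        0≤u⁻¹ = ℚₚ.<⇒≤ (invℚ-pos 0<u)
        0≤v⁻¹ = ℚₚ.<⇒≤ (invℚ-pos 0<v)
        0<i   = invℚ-pos 0<η
    in begin-strict
      ℚ.∣ u⁻¹ ℚ.- v⁻¹ ∣
        ≡⟨ cong ℚ.∣_∣ (cong₂ ℚ._-_
             (sym (trans (cong (u⁻¹ ℚ.*_) (invℚ-inverseʳ 0<v)) (ℚₚ.*-identityʳ u⁻¹)))
             (sym (trans (cong (v⁻¹ ℚ.*_) (invℚ-inverseʳ 0<u)) (ℚₚ.*-identityʳ v⁻¹)))) ⟩
      ℚ.∣ u⁻¹ ℚ.* (v ℚ.* v⁻¹) ℚ.- v⁻¹ ℚ.* (u ℚ.* u⁻¹) ∣
        ≡⟨ cong ℚ.∣_∣ (solve 4 (λ p q r s →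
             r :* (q :* s) :- s :* (p :* r) := (r :* s) :* (q :- p)) refl u v u⁻¹ v⁻¹) ⟩
      ℚ.∣ (u⁻¹ ℚ.* v⁻¹) ℚ.* (v ℚ.- u) ∣
        ≡⟨ ℚₚ.∣p*q∣≡∣p∣*∣q∣ (u⁻¹ ℚ.* v⁻¹) (v ℚ.- u) ⟩
      ℚ.∣ u⁻¹ ℚ.* v⁻¹ ∣ ℚ.* ℚ.∣ v ℚ.- u ∣
        ≡⟨ cong (ℚ._* ℚ.∣ v ℚ.- u ∣)
             (ℚₚ.0≤p⇒∣p∣≡p (ℚₚ.<⇒≤ (invℚ-pos 0<u ∙< invℚ-pos 0<v))) ⟩
      (u⁻¹ ℚ.* v⁻¹) ℚ.* ℚ.∣ v ℚ.- u ∣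
        ≤⟨ ℚₚ.*-monoʳ-≤-nonNeg ℚ.∣ v ℚ.- u ∣ {{ℚₚ.∣-∣-nonNeg (v ℚ.- u)}}
             (*-mono-≤ 0≤v⁻¹ (ℚₚ.<⇒≤ 0<i) (invℚ-anti 0<η η≤u) (invℚ-anti 0<η η≤v)) ⟩
      (i ℚ.* i) ℚ.* ℚ.∣ v ℚ.- u ∣
        <⟨ ℚₚ.*-monoʳ-<-pos (i ℚ.* i) {{ℚ.positive (0<i ∙< 0<i)}}
             (h n m (ℕₚ.m⊔n≤o⇒n≤o M N l≤n) (ℕₚ.m⊔n≤o⇒n≤o M N l≤m)) ⟩
      (i ℚ.* i) ℚ.* δ
        ≡⟨ solve 3 (λ e p q → (q :* q) :* (e :* (p :* p)) := e :* ((p :* q) :* (p :* q)))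
             refl ε η i ⟩
      ε ℚ.* ((η ℚ.* i) ℚ.* (η ℚ.* i))
        ≡⟨ cong (λ t → ε ℚ.* (t ℚ.* t)) (invℚ-inverseʳ 0<η) ⟩
      ε ℚ.* (1ℚ ℚ.* 1ℚ)
        ≡⟨ ℚₚ.*-identityʳ ε ⟩
      ε ∎

record ℂ : Set where
  constructor _+i_
  field
    re im : ℝ

open ℂ public

infix  8 -_
infixl 7 _*_
infixl 6 _+_ _-_
infix  4 _≃_

_≃_ : ℂ → ℂ → Set
z ≃ w = re z ≃ʳ re w × im z ≃ʳ im w

fromℚ : ℚ → ℂ
fromℚ p = fromℚʳ p +i fromℚʳ 0ℚ

fromℤ : ℤ → ℂ
fromℤ k = fromℚ (k ℚ./ 1)

0ℂ 1ℂ : ℂ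
0ℂ = fromℚ 0ℚ
1ℂ = fromℚ 1ℚ

_+_ _*_ : ℂ → ℂ → ℂ
z + w = (re z +ʳ re w) +i (im z +ʳ im w)
z * w = (re z *ʳ re w +ʳ -ʳ (im z *ʳ im w)) +i (re z *ʳ im w +ʳ im z *ʳ re w)

-_ : ℂ → ℂ
- z = (-ʳ re z) +i (-ʳ im z)

_-_ : ℂ → ℂ → ℂ
z - w = z + (- w)

ℂ-rawSemiring : RawSemiring 0ℓ 0ℓ
ℂ-rawSemiring = record
  { Carrier = ℂ ; _≈_ = _≃_ ; _+_ = _+_ ; _*_ = _*_ ; 0# = 0ℂ ; 1# = 1ℂ }

open import Algebra.Definitions.RawSemiring ℂ-rawSemiring public using (_^_)

∣_∣² : ℂ → ℝ
∣ z ∣² = re z *ʳ re z +ʳ im z *ʳ im z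

-- ∣z∣ < r for a positive rational r, stated without square roots.

infix 4 ∣_∣<_
∣_∣<_ : ℂ → ℚ → Set
∣ z ∣< r = ∣ z ∣² <ʳ fromℚʳ (r ℚ.* r)

-- Constructive form of z ≠ 0, i.e. ∣z∣ > 0.

NonZero : ℂ → Set
NonZero z = fromℚʳ 0ℚ <ʳ ∣ z ∣²

-- 1/z is the conjugate of z divided by ∣z∣².

recip : ∀ z → NonZero z → ℂ
recip z z≢0 = (re z *ʳ r) +i (-ʳ im z *ʳ r)
  where r = recip⁺ ∣ z ∣² z≢0

*-nonZero : ∀ z w → NonZero z → NonZero w → NonZero (z * w)
*-nonZero z w (ε , 0<ε , M , f) (δ , 0<δ , N , g) =
  ε ℚ.* δ , (0<ε ∙< 0<δ) , M ℕ.⊔ N , λ n l≤n →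
    let a = seq (re z) n ; b = seq (im z) n ; c = seq (re w) n ; d = seq (im w) n
        ε≤ = subst (ℚ._≤ seq ∣ z ∣² n) (ℚₚ.+-identityˡ ε) (f n (ℕₚ.m⊔n≤o⇒m≤o M N l≤n))
        δ≤ = subst (ℚ._≤ seq ∣ w ∣² n) (ℚₚ.+-identityˡ δ) (g n (ℕₚ.m⊔n≤o⇒n≤o M N l≤n))
        open ℚₚ.≤-Reasoning
    in begin
      0ℚ ℚ.+ ε ℚ.* δ                 ≡⟨ ℚₚ.+-identityˡ (ε ℚ.* δ) ⟩
      ε ℚ.* δ                        ≤⟨ *-mono-≤ (ℚₚ.<⇒≤ 0<δ)
                                          (ℚₚ.≤-trans (ℚₚ.<⇒≤ 0<ε) ε≤) ε≤ δ≤ ⟩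
      seq ∣ z ∣² n ℚ.* seq ∣ w ∣² n  ≡⟨ solve 4 (λ a b c d →
                                          (a :* a :+ b :* b) :* (c :* c :+ d :* d) :=
                                          (a :* c :+ :- (b :* d)) :* (a :* c :+ :- (b :* d)) :+
                                          (a :* d :+ b :* c) :* (a :* d :+ b :* c))
                                          refl a b c d ⟩
      seq ∣ z * w ∣² n               ∎

^-nonZero : ∀ z → NonZero z → ∀ n → NonZero (z ^ n)
^-nonZero z z≢0 zero    = 1ℚ , ℚₚ.positive⁻¹ 1ℚ , 0 , λ _ _ → ℚₚ.≤-refl
^-nonZero z z≢0 (suc n) = *-nonZero z (z ^ n) z≢0 (^-nonZero z z≢0 n)

sum : List ℂ → ℂ
sum = foldr _+_ 0ℂ

-- Unordered summation: s is the limit of the finite partial sums of f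
-- along the finite subsets of I, given as duplicate-free lists.

HasSum : {I : Set} → (I → ℂ) → ℂ → Set
HasSum {I} f s = ∀ ε → 0ℚ ℚ.< ε →
  ∃ λ (S : List I) → ∀ (T : List I) → Unique T → S ⊆ T →
  ∣ sum (map f T) - s ∣< ε

PuncturedDisc : ℂ → Set
PuncturedDisc z = NonZero z × (∣ z ∣< 1ℚ)

-- f z p → ℓ as z → 0 through nonzero complex values.

_⟶₀_ : (∀ z → PuncturedDisc z → ℂ) → ℂ → Set
f ⟶₀ ℓ = ∀ ε → 0ℚ ℚ.< ε → ∃ λ δ → 0ℚ ℚ.< δ ×
  (∀ z (p : PuncturedDisc z) → ∣ z ∣< δ → ∣ f z p - ℓ ∣< ε)

infix 4 _⟶₀_

-- v = ζ(s), for integers s ≥ 2, where ζ is given by its Dirichlet series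
-- ∑ 1/mˢ over m = k + 1 ≥ 1.

IsZeta : ℕ → ℂ → Set
IsZeta s v = HasSum (λ k → fromℚ (ℚ._/_ (ℤ.+ 1) (suc k ℕ.^ s) {{ℕₚ.m^n≢0 (suc k) s}})) v

-- All denominators are nonzero and u = ∑_{k ∈ ℤ} 1/(kᵐ + zᵐ).

IsU : ℕ → ℂ → ℂ → Set
IsU m z u = Σ (∀ k → NonZero (fromℤ k ^ m + z ^ m)) λ d≢0 →
  HasSum (λ k → recip (fromℤ k ^ m + z ^ m) (d≢0 k)) u

{-# OPTIONS --safe #-}

-- For even m, w = zᵐ and k ≥ 1 the terms of U at ±k are both 1/(kᵐ + w), which
-- differs from 1/kᵐ by O(∣w∣/kᵐ), while the term at 0 is exactly 1/w.  Since
-- 1/kᵐ ≤ 1/k² ≤ 2 (1/k − 1/(k + 1)), the differences sum to O(∣w∣) ≤ O(∣z∣), so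
-- U(z) − 1/w → 2 ζ(m).  All estimates are made on the rational approximations at
-- a common index, with constants that do not depend on the index; the same
-- telescoping majorant makes the diagonal sequence of partial sums Cauchy.

module Submission where

open import Defs
open import Algebra.Bundles using (CommutativeRing)
-- The _^_ of Defs is a copy of pow ℂ-rawSemiring, to which IsU unfolds; terms
-- of U written with _^_ would only be identified by unfolding Cauchy proofs.
open import Algebra.Definitions.RawSemiring using () renaming (_^_ to pow)
open import Data.Integer.Base as ℤ using (ℤ; +_; -[1+_])
import Data.Integer.Properties as ℤₚ
open import Data.List.Base using (List; []; _∷_; _++_; map; downFrom)
open import Data.List.Membership.Propositional using (_∈_)
open import Data.List.Membership.Propositional.Properties using (∈-∃++)
open import Data.List.Relation.Binary.Permutation.Propositional as Perm using (_↭_; ↭-trans; ↭-prep)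
open import Data.List.Relation.Binary.Permutation.Propositional.Properties using (∈-resp-↭; shift)
open import Data.List.Relation.Binary.Subset.Propositional using (_⊆_)
open import Data.List.Relation.Unary.All as All using (All; []; _∷_)
open import Data.List.Relation.Unary.AllPairs using ([]; _∷_)
open import Data.List.Relation.Unary.Any using (here; there)
open import Data.List.Relation.Unary.Unique.Propositional using (Unique)
open import Data.List.Relation.Unary.Unique.Propositional.Properties using (downFrom⁺)
open import Data.Nat.Base as ℕ using (ℕ; zero; suc)
import Data.Nat.Properties as ℕₚ
open import Data.Product.Base using (∃; _×_; _,_; proj₁; proj₂)
open import Data.Rational.Base as ℚ using (ℚ; 0ℚ; 1ℚ; ½)
import Data.Rational.Properties as ℚₚ
open import Data.Rational.Solver using (module +-*-Solver)
import Data.Rational.Unnormalised.Base as ℚᵘ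
import Data.Rational.Unnormalised.Properties as ℚᵘₚ
open import Data.Sum.Base using (inj₁; inj₂)
open import Function.Base using (_∘_)
open import Relation.Binary.PropositionalEquality
open import Relation.Nullary using (yes; no; contradiction)

open +-*-Solver using (solve; _:+_; _:*_; :-_; _:-_; _:=_; con)
open import Algebra.Properties.Semiring.Exp
  (CommutativeRing.semiring ℚₚ.+-*-commutativeRing)
  using () renaming (_^_ to _^ℚ_; ^-assocʳ to ^ℚ-assocʳ)

-- `HasSum` and `⟶₀` speak about given complex numbers, so ζ(m) and U(z) must be constructed as
-- Cauchy sequences. The n-th approximation of a sum is the sum of the n-th approximations of the
-- terms over the n-th finite stage of the index set. With this diagonal choice U(z) - 1/w - 2ζ(m)
-- is, at index n, a finite rational sum over 1 ≤ |k| ≤ n, and no limits have to be interchanged.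
-- The price is that the bounds on the terms must hold for all k from one common index on. They do,
-- because k enters only through the exact rational kᵐ; the one inexact quantity is w.
--
-- The bound |kᵐ + w| ≥ ηkᵐ for k ≠ 0, valid when |w| ≤ r ≤ 1 - η, is used with two choices of
-- constants. For the existence of U(z) on the whole punctured disc, η and r depend on z. For the
-- limit, η = ½ and r = δ serve all z at once. The two uses fit together because the approximations
-- of a reciprocal and of a sum do not involve the proofs of nonvanishing and of convergence.

-- Order, absolute value and total reciprocal on the rationals.

≤-by : ∀ {p q} d → 0ℚ ℚ.≤ d → p ℚ.+ d ≡ q → p ℚ.≤ q
≤-by {p} d 0≤d refl = subst (ℚ._≤ p ℚ.+ d) (ℚₚ.+-identityʳ p) (ℚₚ.+-monoʳ-≤ p 0≤d)

p≤q⇒0≤q-p : ∀ {p q} → p ℚ.≤ q → 0ℚ ℚ.≤ q ℚ.- p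
p≤q⇒0≤q-p {p} {q} p≤q = subst (ℚ._≤ q ℚ.- p) (ℚₚ.+-inverseʳ p) (ℚₚ.+-monoˡ-≤ (ℚ.- p) p≤q)

0≤p+q : ∀ {p q} → 0ℚ ℚ.≤ p → 0ℚ ℚ.≤ q → 0ℚ ℚ.≤ p ℚ.+ q
0≤p+q = ℚₚ.+-mono-≤

0≤p*q : ∀ {p q} → 0ℚ ℚ.≤ p → 0ℚ ℚ.≤ q → 0ℚ ℚ.≤ p ℚ.* q
0≤p*q {p} {q} 0≤p 0≤q = subst (ℚ._≤ p ℚ.* q) (ℚₚ.*-zeroʳ p)
  (ℚₚ.*-monoˡ-≤-nonNeg p {{ℚ.nonNegative 0≤p}} 0≤q)

0<p*q : ∀ {p q} → 0ℚ ℚ.< p → 0ℚ ℚ.< q → 0ℚ ℚ.< p ℚ.* q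
0<p*q {p} {q} 0<p 0<q = subst (ℚ._< p ℚ.* q) (ℚₚ.*-zeroʳ p)
  (ℚₚ.*-monoʳ-<-pos p {{ℚ.positive 0<p}} 0<q)

*-monoʳ-≤ : ∀ {p q} r → 0ℚ ℚ.≤ r → p ℚ.≤ q → r ℚ.* p ℚ.≤ r ℚ.* q
*-monoʳ-≤ r 0≤r = ℚₚ.*-monoˡ-≤-nonNeg r {{ℚ.nonNegative 0≤r}}

*-mono-≤ : ∀ {p q r s} → 0ℚ ℚ.≤ r → 0ℚ ℚ.≤ q → p ℚ.≤ q → r ℚ.≤ s → p ℚ.* r ℚ.≤ q ℚ.* s
*-mono-≤ {p} {q} {r} {s} 0≤r 0≤q p≤q r≤s = ℚₚ.≤-trans
  (ℚₚ.*-monoʳ-≤-nonNeg r {{ℚ.nonNegative 0≤r}} p≤q) (*-monoʳ-≤ q 0≤q r≤s)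

p≤∣p∣ : ∀ p → p ℚ.≤ ℚ.∣ p ∣
p≤∣p∣ p with ℚₚ.≤-total 0ℚ p
... | inj₁ 0≤p = ℚₚ.≤-reflexive (sym (ℚₚ.0≤p⇒∣p∣≡p 0≤p))
... | inj₂ p≤0 = ℚₚ.≤-trans p≤0 (ℚₚ.0≤∣p∣ p)

-p≤∣p∣ : ∀ p → ℚ.- p ℚ.≤ ℚ.∣ p ∣
-p≤∣p∣ p = subst (ℚ.- p ℚ.≤_) (ℚₚ.∣-p∣≡∣p∣ p) (p≤∣p∣ (ℚ.- p))

0≤p² : ∀ p → 0ℚ ℚ.≤ p ℚ.* p
0≤p² p with ℚₚ.≤-total 0ℚ p
... | inj₁ 0≤p = 0≤p*q 0≤p 0≤p
... | inj₂ p≤0 = subst (0ℚ ℚ.≤_) (solve 1 (λ p → (:- p) :* (:- p) := p :* p) refl p)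
                   (0≤p*q (ℚₚ.neg-antimono-≤ p≤0) (ℚₚ.neg-antimono-≤ p≤0))

∣p∣²≡p² : ∀ p → ℚ.∣ p ∣ ℚ.* ℚ.∣ p ∣ ≡ p ℚ.* p
∣p∣²≡p² p = trans (sym (ℚₚ.∣p*q∣≡∣p∣*∣q∣ p p)) (ℚₚ.0≤p⇒∣p∣≡p (0≤p² p))

p²≤r²⇒∣p∣≤r : ∀ p {r} → 0ℚ ℚ.≤ r → p ℚ.* p ℚ.≤ r ℚ.* r → ℚ.∣ p ∣ ℚ.≤ r
p²≤r²⇒∣p∣≤r p {r} 0≤r p²≤r² with ℚ.∣ p ∣ ℚₚ.≤? r
... | yes ∣p∣≤r = ∣p∣≤r
... | no  ∣p∣≰r = contradiction refl (ℚₚ.<⇒≢ (begin-strict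
  p ℚ.* p                ≤⟨ p²≤r² ⟩
  r ℚ.* r                ≤⟨ *-monoʳ-≤ r 0≤r (ℚₚ.<⇒≤ r<∣p∣) ⟩
  r ℚ.* ℚ.∣ p ∣          <⟨ ℚₚ.*-monoˡ-<-pos ℚ.∣ p ∣ {{ℚ.positive (ℚₚ.≤-<-trans 0≤r r<∣p∣)}} r<∣p∣ ⟩
  ℚ.∣ p ∣ ℚ.* ℚ.∣ p ∣    ≡⟨ ∣p∣²≡p² p ⟩
  p ℚ.* p                ∎))
  where
  open ℚₚ.≤-Reasoning
  r<∣p∣ = ℚₚ.≰⇒> ∣p∣≰r

∣p∣≤r⇒p²≤r² : ∀ p {r} → ℚ.∣ p ∣ ℚ.≤ r → p ℚ.* p ℚ.≤ r ℚ.* r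
∣p∣≤r⇒p²≤r² p {r} ∣p∣≤r = subst (ℚ._≤ r ℚ.* r) (∣p∣²≡p² p)
  (*-mono-≤ (ℚₚ.0≤∣p∣ p) (ℚₚ.≤-trans (ℚₚ.0≤∣p∣ p) ∣p∣≤r) ∣p∣≤r ∣p∣≤r)

∣p-q∣-triangle : ∀ p q r → ℚ.∣ p ℚ.- r ∣ ℚ.≤ ℚ.∣ p ℚ.- q ∣ ℚ.+ ℚ.∣ q ℚ.- r ∣
∣p-q∣-triangle p q r = subst (λ d → ℚ.∣ d ∣ ℚ.≤ ℚ.∣ p ℚ.- q ∣ ℚ.+ ℚ.∣ q ℚ.- r ∣)
  (solve 3 (λ p q r → (p :- q) :+ (q :- r) := p :- r) refl p q r)
  (ℚₚ.∣p+q∣≤∣p∣+∣q∣ (p ℚ.- q) (q ℚ.- r))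

∣p-q∣-comm : ∀ p q → ℚ.∣ p ℚ.- q ∣ ≡ ℚ.∣ q ℚ.- p ∣
∣p-q∣-comm p q = trans (sym (ℚₚ.∣-p∣≡∣p∣ (p ℚ.- q)))
  (cong ℚ.∣_∣ (solve 2 (λ p q → :- (p :- q) := q :- p) refl p q))

invℚ-unique : ∀ {p q} → 0ℚ ℚ.< p → p ℚ.* q ≡ 1ℚ → invℚ p ≡ q
invℚ-unique {p} {q} 0<p pq≡1 = begin
  invℚ p                  ≡⟨ ℚₚ.*-identityʳ (invℚ p) ⟨
  invℚ p ℚ.* 1ℚ           ≡⟨ cong (invℚ p ℚ.*_) pq≡1 ⟨
  invℚ p ℚ.* (p ℚ.* q)    ≡⟨ solve 3 (λ i p q → i :* (p :* q) := (p :* i) :* q) refl (invℚ p) p q ⟩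
  (p ℚ.* invℚ p) ℚ.* q    ≡⟨ cong (ℚ._* q) (invℚ-inverseʳ 0<p) ⟩
  1ℚ ℚ.* q                ≡⟨ ℚₚ.*-identityˡ q ⟩
  q                       ∎
  where open ≡-Reasoning

invℚ-* : ∀ {p q} → 0ℚ ℚ.< p → 0ℚ ℚ.< q → invℚ (p ℚ.* q) ≡ invℚ p ℚ.* invℚ q
invℚ-* {p} {q} 0<p 0<q = invℚ-unique (0<p*q 0<p 0<q) (begin
  (p ℚ.* q) ℚ.* (invℚ p ℚ.* invℚ q)
    ≡⟨ solve 4 (λ p q i j → (p :* q) :* (i :* j) := (p :* i) :* (q :* j)) refl p q (invℚ p) (invℚ q) ⟩
  (p ℚ.* invℚ p) ℚ.* (q ℚ.* invℚ q)
    ≡⟨ cong₂ ℚ._*_ (invℚ-inverseʳ 0<p) (invℚ-inverseʳ 0<q) ⟩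
  1ℚ ∎)
  where open ≡-Reasoning

-- Powers of rationals.

^ℚ-bounded : ∀ {x} m → 0ℚ ℚ.≤ x → x ℚ.≤ 1ℚ → 0ℚ ℚ.≤ x ^ℚ m × x ^ℚ m ℚ.≤ 1ℚ
^ℚ-bounded zero    0≤x x≤1 = ℚₚ.nonNegative⁻¹ 1ℚ , ℚₚ.≤-refl
^ℚ-bounded (suc m) 0≤x x≤1 =
  let 0≤xᵐ , xᵐ≤1 = ^ℚ-bounded m 0≤x x≤1
  in 0≤p*q 0≤x 0≤xᵐ , *-mono-≤ 0≤xᵐ (ℚₚ.nonNegative⁻¹ 1ℚ) x≤1 xᵐ≤1

x^m≤x : ∀ {x m} → 1 ℕ.≤ m → 0ℚ ℚ.≤ x → x ℚ.≤ 1ℚ → x ^ℚ m ℚ.≤ x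
x^m≤x {x} {suc m} _ 0≤x x≤1 = subst (x ^ℚ suc m ℚ.≤_) (ℚₚ.*-identityʳ x)
  (*-monoʳ-≤ x 0≤x (proj₂ (^ℚ-bounded m 0≤x x≤1)))

1≤x⇒0<x : ∀ {x} → 1ℚ ℚ.≤ x → 0ℚ ℚ.< x
1≤x⇒0<x = ℚₚ.<-≤-trans (ℚₚ.positive⁻¹ 1ℚ)

1≤x^m : ∀ {x} m → 1ℚ ℚ.≤ x → 1ℚ ℚ.≤ x ^ℚ m
1≤x^m zero    1≤x = ℚₚ.≤-refl
1≤x^m (suc m) 1≤x =
  *-mono-≤ (ℚₚ.nonNegative⁻¹ 1ℚ) (ℚₚ.<⇒≤ (1≤x⇒0<x 1≤x)) 1≤x (1≤x^m m 1≤x)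

x²≤x^m : ∀ {x m} → 2 ℕ.≤ m → 1ℚ ℚ.≤ x → x ℚ.* x ℚ.≤ x ^ℚ m
x²≤x^m {x} {suc (suc m)} _ 1≤x = *-monoʳ-≤ x 0≤x
  (subst (ℚ._≤ x ^ℚ suc m) (ℚₚ.*-identityʳ x) (*-monoʳ-≤ x 0≤x (1≤x^m m 1≤x)))
  where 0≤x = ℚₚ.<⇒≤ (1≤x⇒0<x 1≤x)
x²≤x^m {m = suc zero} (ℕ.s≤s ())

-- The shape 2n of the exponent matters for this and for 2 ≤ 2n; the analysis below is carried out
-- for any exponent `m` with these two properties.
even-^ℚ : ∀ x n → (ℚ.- x) ^ℚ (2 ℕ.* n) ≡ x ^ℚ (2 ℕ.* n)
even-^ℚ x n = begin
  (ℚ.- x) ^ℚ (2 ℕ.* n)   ≡⟨ ^ℚ-assocʳ (ℚ.- x) 2 n ⟨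
  ((ℚ.- x) ^ℚ 2) ^ℚ n    ≡⟨ cong (_^ℚ n) (solve 1 (λ x →
                              (:- x) :* ((:- x) :* con 1ℚ) := x :* (x :* con 1ℚ)) refl x) ⟩
  (x ^ℚ 2) ^ℚ n          ≡⟨ ^ℚ-assocʳ x 2 n ⟩
  x ^ℚ (2 ℕ.* n)         ∎
  where open ≡-Reasoning

-- The naturals inside the rationals and the Archimedean property.

fromℕ : ℕ → ℚ
fromℕ n = + n ℚ./ 1

toℚᵘ-fromℕ : ∀ n → ℚ.toℚᵘ (fromℕ n) ℚᵘ.≃ (+ n ℚᵘ./ 1)
toℚᵘ-fromℕ n = ℚₚ.toℚᵘ-fromℚᵘ (+ n ℚᵘ./ 1)

fromℕ-* : ∀ m n → fromℕ (m ℕ.* n) ≡ fromℕ m ℚ.* fromℕ n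
fromℕ-* m n = ℚₚ.toℚᵘ-injective (begin
  ℚ.toℚᵘ (fromℕ (m ℕ.* n))                     ≈⟨ toℚᵘ-fromℕ (m ℕ.* n) ⟩
  (+ (m ℕ.* n)) ℚᵘ./ 1                         ≈⟨ ℚᵘ.*≡* (cong (ℤ._* ℤ.1ℤ) (ℤₚ.pos-* m n)) ⟩
  (+ m ℚᵘ./ 1) ℚᵘ.* (+ n ℚᵘ./ 1)               ≈⟨ ℚᵘₚ.*-cong (toℚᵘ-fromℕ m) (toℚᵘ-fromℕ n) ⟨
  ℚ.toℚᵘ (fromℕ m) ℚᵘ.* ℚ.toℚᵘ (fromℕ n)       ≈⟨ ℚₚ.toℚᵘ-homo-* (fromℕ m) (fromℕ n) ⟨
  ℚ.toℚᵘ (fromℕ m ℚ.* fromℕ n)                 ∎)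
  where open ℚᵘₚ.≃-Reasoning

fromℕ-suc : ∀ n → fromℕ (suc n) ≡ fromℕ n ℚ.+ 1ℚ
fromℕ-suc n = ℚₚ.toℚᵘ-injective (begin
  ℚ.toℚᵘ (fromℕ (suc n))               ≈⟨ toℚᵘ-fromℕ (suc n) ⟩
  (+ suc n) ℚᵘ./ 1                     ≈⟨ ℚᵘ.*≡* (cong (ℤ._* ℤ.1ℤ) lemma) ⟩
  (+ n ℚᵘ./ 1) ℚᵘ.+ ℚᵘ.1ℚᵘ             ≈⟨ ℚᵘₚ.+-congˡ ℚᵘ.1ℚᵘ (toℚᵘ-fromℕ n) ⟨
  ℚ.toℚᵘ (fromℕ n) ℚᵘ.+ ℚ.toℚᵘ 1ℚ      ≈⟨ ℚₚ.toℚᵘ-homo-+ (fromℕ n) 1ℚ ⟨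
  ℚ.toℚᵘ (fromℕ n ℚ.+ 1ℚ)              ∎)
  where
  open ℚᵘₚ.≃-Reasoning
  lemma : + suc n ≡ (+ n ℤ.* ℤ.1ℤ) ℤ.+ ℤ.1ℤ
  lemma = trans (cong +_ (ℕₚ.+-comm 1 n)) (cong (ℤ._+ ℤ.1ℤ) (sym (ℤₚ.*-identityʳ (+ n))))

fromℕ-^ : ∀ m n → fromℕ (m ℕ.^ n) ≡ fromℕ m ^ℚ n
fromℕ-^ m zero    = refl
fromℕ-^ m (suc n) = trans (fromℕ-* m (m ℕ.^ n)) (cong (fromℕ m ℚ.*_) (fromℕ-^ m n))

1≤fromℕ-suc : ∀ n → 1ℚ ℚ.≤ fromℕ (suc n)
1≤fromℕ-suc zero    = ℚₚ.≤-refl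
1≤fromℕ-suc (suc n) = ≤-by {1ℚ} (fromℕ (suc n)) (ℚₚ.<⇒≤ (1≤x⇒0<x (1≤fromℕ-suc n)))
  (trans (ℚₚ.+-comm 1ℚ (fromℕ (suc n))) (sym (fromℕ-suc (suc n))))

0<fromℕ-suc : ∀ n → 0ℚ ℚ.< fromℕ (suc n)
0<fromℕ-suc n = 1≤x⇒0<x (1≤fromℕ-suc n)

-- Translates the fractions in `IsZeta` into the reciprocal that `recip` and all estimates use.
1/d≡invℚ : ∀ d .{{_ : ℕ.NonZero d}} → ℤ.1ℤ ℚ./ d ≡ invℚ (fromℕ d)
1/d≡invℚ (suc d) = sym (invℚ-unique (0<fromℕ-suc d) (ℚₚ.toℚᵘ-injective (begin
  ℚ.toℚᵘ (fromℕ (suc d) ℚ.* (ℤ.1ℤ ℚ./ suc d))            ≈⟨ ℚₚ.toℚᵘ-homo-* (fromℕ (suc d)) (ℤ.1ℤ ℚ./ suc d) ⟩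
  ℚ.toℚᵘ (fromℕ (suc d)) ℚᵘ.* ℚ.toℚᵘ (ℤ.1ℤ ℚ./ suc d)    ≈⟨ ℚᵘₚ.*-cong (toℚᵘ-fromℕ (suc d)) (ℚₚ.toℚᵘ-fromℚᵘ (ℤ.1ℤ ℚᵘ./ suc d)) ⟩
  (+ suc d ℚᵘ./ 1) ℚᵘ.* (ℤ.1ℤ ℚᵘ./ suc d)                ≈⟨ ℚᵘ.*≡* lemma ⟩
  ℚᵘ.1ℚᵘ                                                 ∎)))
  where
  open ℚᵘₚ.≃-Reasoning
  lemma : + suc d ℤ.* ℤ.1ℤ ℤ.* ℤ.1ℤ ≡ ℤ.1ℤ ℤ.* + (1 ℕ.* suc d)
  lemma = trans (ℤₚ.*-identityʳ (+ suc d ℤ.* ℤ.1ℤ)) (trans (ℤₚ.*-identityʳ (+ suc d))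
    (sym (trans (ℤₚ.*-identityˡ (+ (1 ℕ.* suc d))) (cong +_ (ℕₚ.*-identityˡ (suc d))))))

-- The denominator is at least 1, so a fraction never exceeds the absolute value of its numerator.
archimedean : ∀ p → ∃ λ n → p ℚ.< fromℕ (suc n)
archimedean p@(ℚ.mkℚ _ _ _) = ℤ.∣ ℚ.↥ p ∣ , ℚₚ.toℚᵘ-cancel-< (ℚᵘₚ.<-respʳ-≃ (ℚᵘₚ.≃-sym (toℚᵘ-fromℕ (suc ℤ.∣ ℚ.↥ p ∣)))
  (ℚᵘ.*<* (begin-strict
    ℚ.↥ p ℤ.* ℤ.1ℤ                             ≡⟨ ℤₚ.*-identityʳ (ℚ.↥ p) ⟩
    ℚ.↥ p                                      ≤⟨ i≤∣i∣ (ℚ.↥ p) ⟩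
    + ℤ.∣ ℚ.↥ p ∣                              <⟨ ℤ.+<+ (ℕₚ.n<1+n ℤ.∣ ℚ.↥ p ∣) ⟩
    + suc ℤ.∣ ℚ.↥ p ∣                          ≤⟨ ℤ.+≤+ (ℕₚ.m≤m*n (suc ℤ.∣ ℚ.↥ p ∣) (ℚ.↧ₙ p)) ⟩
    + (suc ℤ.∣ ℚ.↥ p ∣ ℕ.* ℚ.↧ₙ p)             ≡⟨ ℤₚ.pos-* (suc ℤ.∣ ℚ.↥ p ∣) (ℚ.↧ₙ p) ⟩
    + suc ℤ.∣ ℚ.↥ p ∣ ℤ.* ℚ.↧ p ∎)))
  where
  open ℤₚ.≤-Reasoning
  i≤∣i∣ : ∀ i → i ℤ.≤ + ℤ.∣ i ∣
  i≤∣i∣ (+ n)    = ℤₚ.≤-refl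
  i≤∣i∣ -[1+ n ] = ℤ.-≤+

-- The telescoping majorant of 1/k².

recipℕ : ℕ → ℚ
recipℕ j = invℚ (fromℕ (suc j))

0≤recipℕ : ∀ j → 0ℚ ℚ.≤ recipℕ j
0≤recipℕ j = ℚₚ.<⇒≤ (invℚ-pos (0<fromℕ-suc j))

recipℕ-null : ∀ C {ε} → 0ℚ ℚ.< ε → ∃ λ n → C ℚ.* recipℕ n ℚ.< ε
recipℕ-null C {ε} 0<ε with archimedean (C ℚ.* invℚ ε)
... | n , C/ε<n+1 = n , ℚₚ.*-cancelˡ-<-nonNeg N {{ℚ.nonNegative (ℚₚ.<⇒≤ 0<N)}} (begin-strict
    N ℚ.* (C ℚ.* invℚ N)          ≡⟨ solve 3 (λ N C i → N :* (C :* i) := C :* (N :* i)) refl N C (invℚ N) ⟩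
    C ℚ.* (N ℚ.* invℚ N)          ≡⟨ cong (C ℚ.*_) (trans (invℚ-inverseʳ 0<N) (sym (invℚ-inverseʳ 0<ε))) ⟩
    C ℚ.* (ε ℚ.* invℚ ε)          ≡⟨ solve 3 (λ e C i → C :* (e :* i) := (C :* i) :* e) refl ε C (invℚ ε) ⟩
    (C ℚ.* invℚ ε) ℚ.* ε          <⟨ ℚₚ.*-monoˡ-<-pos ε {{ℚ.positive 0<ε}} C/ε<n+1 ⟩
    N ℚ.* ε                       ∎)
  where
  open ℚₚ.≤-Reasoning
  N   = fromℕ (suc n)
  0<N = 0<fromℕ-suc n

gap : ℕ → ℚ
gap j = recipℕ j ℚ.- recipℕ (suc j)

-- With q = j + 1: 1/q − 1/(q + 1) = 1/(q (q + 1)), and q + 1 ≤ 2q.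
recipℕ²≤2gap : ∀ j → recipℕ j ℚ.* recipℕ j ℚ.≤ gap j ℚ.+ gap j
recipℕ²≤2gap j = ≤-by {t ℚ.* t} (t ℚ.* t ℚ.* (u ℚ.* (q ℚ.- 1ℚ)))
  (0≤p*q (0≤p*q 0≤t 0≤t) (0≤p*q 0≤u (p≤q⇒0≤q-p (1≤fromℕ-suc j)))) (begin
    t ℚ.* t ℚ.+ t ℚ.* t ℚ.* (u ℚ.* (q ℚ.- 1ℚ))
      ≡⟨ cong (ℚ._+ t ℚ.* t ℚ.* (u ℚ.* (q ℚ.- 1ℚ))) (trans (cong (t ℚ.* t ℚ.*_) q′u≡1) (ℚₚ.*-identityʳ (t ℚ.* t))) ⟨
    t ℚ.* t ℚ.* ((q ℚ.+ 1ℚ) ℚ.* u) ℚ.+ t ℚ.* t ℚ.* (u ℚ.* (q ℚ.- 1ℚ))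
      ≡⟨ solve 3 (λ q t u → t :* t :* ((q :+ con 1ℚ) :* u) :+ t :* t :* (u :* (q :- con 1ℚ))
                          := (q :* t) :* (t :* u) :+ (q :* t) :* (t :* u)) refl q t u ⟩
    (q ℚ.* t) ℚ.* (t ℚ.* u) ℚ.+ (q ℚ.* t) ℚ.* (t ℚ.* u)
      ≡⟨ cong (λ e → e ℚ.+ e) (trans (cong (ℚ._* (t ℚ.* u)) qt≡1) (trans (ℚₚ.*-identityˡ (t ℚ.* u)) tu≡gap)) ⟩
    gap j ℚ.+ gap j ∎)
  where
  open ≡-Reasoning
  q = fromℕ (suc j)
  t = recipℕ j
  u = recipℕ (suc j)
  0≤t = 0≤recipℕ j
  0≤u = 0≤recipℕ (suc j)
  qt≡1 : q ℚ.* t ≡ 1ℚ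
  qt≡1 = invℚ-inverseʳ (0<fromℕ-suc j)
  q′u≡1 : (q ℚ.+ 1ℚ) ℚ.* u ≡ 1ℚ
  q′u≡1 = trans (cong (ℚ._* u) (sym (fromℕ-suc (suc j)))) (invℚ-inverseʳ (0<fromℕ-suc (suc j)))
  tu≡gap : t ℚ.* u ≡ gap j
  tu≡gap = begin
    t ℚ.* u
      ≡⟨ solve 3 (λ q t u → t :* u := t :* ((q :+ con 1ℚ) :* u) :- (q :* t) :* u) refl q t u ⟩
    t ℚ.* ((q ℚ.+ 1ℚ) ℚ.* u) ℚ.- (q ℚ.* t) ℚ.* u
      ≡⟨ cong₂ (λ d e → t ℚ.* d ℚ.- e ℚ.* u) q′u≡1 qt≡1 ⟩
    t ℚ.* 1ℚ ℚ.- 1ℚ ℚ.* u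
      ≡⟨ cong₂ ℚ._-_ (ℚₚ.*-identityʳ t) (ℚₚ.*-identityˡ u) ⟩
    gap j ∎

-- Estimates for 1/(K + w), where K stands for kᵐ, w = a + ib and |w| ≤ r ≤ 1 - η.

-- `D` will be |K + w|². One factor K of the numerator cancels against K² in `D`, which leaves a
-- multiple of 1/K and hence something summable over k.
quotient-bound : ∀ {η K s D} x → 0ℚ ℚ.< η → 1ℚ ℚ.≤ K → 0ℚ ℚ.≤ s →
  ℚ.∣ x ∣ ℚ.≤ s ℚ.* K → (η ℚ.* K) ℚ.* (η ℚ.* K) ℚ.≤ D →
  ℚ.∣ x ℚ.* invℚ D ∣ ℚ.≤ s ℚ.* (invℚ η ℚ.* invℚ η) ℚ.* invℚ K
quotient-bound {η} {K} {s} {D} x 0<η 1≤K 0≤s ∣x∣≤sK D₀≤D = begin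
  ℚ.∣ x ℚ.* invℚ D ∣                          ≡⟨ ℚₚ.∣p*q∣≡∣p∣*∣q∣ x (invℚ D) ⟩
  ℚ.∣ x ∣ ℚ.* ℚ.∣ invℚ D ∣                    ≡⟨ cong (ℚ.∣ x ∣ ℚ.*_) (ℚₚ.0≤p⇒∣p∣≡p 0≤1/D) ⟩
  ℚ.∣ x ∣ ℚ.* invℚ D                          ≤⟨ *-mono-≤ 0≤1/D (0≤p*q 0≤s (ℚₚ.<⇒≤ 0<K)) ∣x∣≤sK (invℚ-anti 0<D₀ D₀≤D) ⟩
  s ℚ.* K ℚ.* invℚ D₀                         ≡⟨ cong (s ℚ.* K ℚ.*_) (trans (invℚ-* 0<ηK 0<ηK)
                                                   (cong (λ e → e ℚ.* e) (invℚ-* 0<η 0<K))) ⟩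
  s ℚ.* K ℚ.* (i ℚ.* κ ℚ.* (i ℚ.* κ))         ≡⟨ solve 4 (λ s K i κ → s :* K :* (i :* κ :* (i :* κ))
                                                        := s :* (i :* i) :* κ :* (K :* κ)) refl s K i κ ⟩
  s ℚ.* (i ℚ.* i) ℚ.* κ ℚ.* (K ℚ.* κ)         ≡⟨ cong (s ℚ.* (i ℚ.* i) ℚ.* κ ℚ.*_) (invℚ-inverseʳ 0<K) ⟩
  s ℚ.* (i ℚ.* i) ℚ.* κ ℚ.* 1ℚ                ≡⟨ ℚₚ.*-identityʳ (s ℚ.* (i ℚ.* i) ℚ.* κ) ⟩
  s ℚ.* (i ℚ.* i) ℚ.* κ                       ∎
  where
  open ℚₚ.≤-Reasoning
  i    = invℚ η
  κ    = invℚ K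
  0<K  = 1≤x⇒0<x 1≤K
  0<ηK = 0<p*q 0<η 0<K
  D₀   = (η ℚ.* K) ℚ.* (η ℚ.* K)
  0<D₀ = 0<p*q 0<ηK 0<ηK
  0≤1/D = ℚₚ.<⇒≤ (invℚ-pos (ℚₚ.<-≤-trans 0<D₀ D₀≤D))

normSq : ℚ → ℚ → ℚ
normSq x y = x ℚ.* x ℚ.+ y ℚ.* y

∣re∣≤r : ∀ a b {r} → 0ℚ ℚ.≤ r → normSq a b ℚ.≤ r ℚ.* r → ℚ.∣ a ∣ ℚ.≤ r
∣re∣≤r a b 0≤r ab≤r² = p²≤r²⇒∣p∣≤r a 0≤r (ℚₚ.≤-trans (≤-by (b ℚ.* b) (0≤p² b) refl) ab≤r²)

∣im∣≤r : ∀ a b {r} → 0ℚ ℚ.≤ r → normSq a b ℚ.≤ r ℚ.* r → ℚ.∣ b ∣ ℚ.≤ r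
∣im∣≤r a b 0≤r ab≤r² =
  p²≤r²⇒∣p∣≤r b 0≤r (ℚₚ.≤-trans (≤-by (a ℚ.* a) (0≤p² a) (ℚₚ.+-comm (b ℚ.* b) (a ℚ.* a))) ab≤r²)

-- The real part alone suffices: (1 - η)K ≥ 1 - η ≥ r gives K + a ≥ K - r ≥ ηK ≥ 0.
normSq-shift-lower : ∀ {η K r} a b → 0ℚ ℚ.≤ η → 1ℚ ℚ.≤ K → 0ℚ ℚ.≤ r → r ℚ.+ η ℚ.≤ 1ℚ →
  ℚ.∣ a ∣ ℚ.≤ r → (η ℚ.* K) ℚ.* (η ℚ.* K) ℚ.≤ normSq (K ℚ.+ a) b
normSq-shift-lower {η} {K} {r} a b 0≤η 1≤K 0≤r r+η≤1 ∣a∣≤r = ℚₚ.≤-trans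
  (*-mono-≤ 0≤ηK (ℚₚ.≤-trans 0≤ηK ηK≤K+a) ηK≤K+a ηK≤K+a)
  (≤-by (b ℚ.* b) (0≤p² b) refl)
  where
  0≤ηK = 0≤p*q 0≤η (ℚₚ.<⇒≤ (1≤x⇒0<x 1≤K))
  η≤1 : η ℚ.≤ 1ℚ
  η≤1 = ℚₚ.≤-trans (≤-by r 0≤r (ℚₚ.+-comm η r)) r+η≤1
  0≤r+a : 0ℚ ℚ.≤ r ℚ.- ℚ.- a
  0≤r+a = p≤q⇒0≤q-p (ℚₚ.≤-trans (-p≤∣p∣ a) ∣a∣≤r)
  ηK≤K+a : η ℚ.* K ℚ.≤ K ℚ.+ a
  ηK≤K+a = ≤-by
    ((K ℚ.- 1ℚ) ℚ.* (1ℚ ℚ.- η) ℚ.+ ((1ℚ ℚ.- (r ℚ.+ η)) ℚ.+ (r ℚ.- ℚ.- a)))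
    (0≤p+q (0≤p*q (p≤q⇒0≤q-p 1≤K) (p≤q⇒0≤q-p η≤1)) (0≤p+q (p≤q⇒0≤q-p r+η≤1) 0≤r+a))
    (solve 4 (λ η K r a → η :* K :+ ((K :- con 1ℚ) :* (con 1ℚ :- η) :+
       ((con 1ℚ :- (r :+ η)) :+ (r :- :- a))) := K :+ a) refl η K r a)

-- Shaped exactly like the components of `recip`, so that the approximations of a reciprocal compute
-- to these.
invRe invIm : ℚ → ℚ → ℚ
invRe x y = x ℚ.* invℚ (normSq x y)
invIm x y = (ℚ.- y) ℚ.* invℚ (normSq x y)

2ℚ : ℚ
2ℚ = 1ℚ ℚ.+ 1ℚ

module _ {η K r : ℚ} (a b : ℚ) (0<η : 0ℚ ℚ.< η) (1≤K : 1ℚ ℚ.≤ K) (0≤r : 0ℚ ℚ.≤ r)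
         (r+η≤1 : r ℚ.+ η ℚ.≤ 1ℚ) (ab≤r² : normSq a b ℚ.≤ r ℚ.* r) where

  private
    0≤η = ℚₚ.<⇒≤ 0<η
    0≤K = ℚₚ.<⇒≤ (1≤x⇒0<x 1≤K)
    ∣a∣≤r = ∣re∣≤r a b 0≤r ab≤r²
    ∣b∣≤r = ∣im∣≤r a b 0≤r ab≤r²
    r≤1 : r ℚ.≤ 1ℚ
    r≤1 = ℚₚ.≤-trans (≤-by η 0≤η refl) r+η≤1
    D = normSq (K ℚ.+ a) b

    s≤sK : ∀ {s} → 0ℚ ℚ.≤ s → s ℚ.≤ s ℚ.* K
    s≤sK {s} 0≤s = subst (ℚ._≤ s ℚ.* K) (ℚₚ.*-identityʳ s) (*-monoʳ-≤ s 0≤s 1≤K)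

    r≤2r : r ℚ.≤ 2ℚ ℚ.* r
    r≤2r = ≤-by r 0≤r (solve 1 (λ r → r :+ r := con 2ℚ :* r) refl r)

  ηK²≤D : (η ℚ.* K) ℚ.* (η ℚ.* K) ℚ.≤ D
  ηK²≤D = normSq-shift-lower a b 0≤η 1≤K 0≤r r+η≤1 ∣a∣≤r

  -- Free of `K`, this is the gap that witnesses that the denominators at k ≠ 0 do not vanish.
  η²≤D : η ℚ.* η ℚ.≤ D
  η²≤D = ℚₚ.≤-trans (*-mono-≤ 0≤η (0≤p*q 0≤η 0≤K) (s≤sK 0≤η) (s≤sK 0≤η)) ηK²≤D

  private
    0<D : 0ℚ ℚ.< D
    0<D = ℚₚ.<-≤-trans (0<p*q 0<η 0<η) η²≤D

  -- Has no factor r: it serves the existence of the sum, where |w| need not be small. The two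
  -- bounds ending in `-close` carry the factor r and serve the limit.
  invRe-bound : ℚ.∣ invRe (K ℚ.+ a) b ∣ ℚ.≤ 2ℚ ℚ.* (invℚ η ℚ.* invℚ η) ℚ.* invℚ K
  invRe-bound = quotient-bound (K ℚ.+ a) 0<η 1≤K (ℚₚ.nonNegative⁻¹ 2ℚ) (begin
    ℚ.∣ K ℚ.+ a ∣           ≤⟨ ℚₚ.∣p+q∣≤∣p∣+∣q∣ K a ⟩
    ℚ.∣ K ∣ ℚ.+ ℚ.∣ a ∣     ≤⟨ ℚₚ.+-mono-≤ (ℚₚ.≤-reflexive (ℚₚ.0≤p⇒∣p∣≡p 0≤K))
                                 (ℚₚ.≤-trans ∣a∣≤r (ℚₚ.≤-trans r≤1 1≤K)) ⟩
    K ℚ.+ K                 ≡⟨ solve 1 (λ K → K :+ K := con 2ℚ :* K) refl K ⟩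
    2ℚ ℚ.* K                ∎) ηK²≤D
    where open ℚₚ.≤-Reasoning

  invIm-bound : ℚ.∣ invIm (K ℚ.+ a) b ∣ ℚ.≤ 2ℚ ℚ.* (invℚ η ℚ.* invℚ η) ℚ.* invℚ K
  invIm-bound = quotient-bound (ℚ.- b) 0<η 1≤K (ℚₚ.nonNegative⁻¹ 2ℚ)
    (subst (ℚ._≤ 2ℚ ℚ.* K) (sym (ℚₚ.∣-p∣≡∣p∣ b)) (ℚₚ.≤-trans ∣b∣≤r (ℚₚ.≤-trans r≤1
      (ℚₚ.≤-trans 1≤K (≤-by K 0≤K (solve 1 (λ K → K :+ K := con 2ℚ :* K) refl K)))))) ηK²≤D

  -- Since 1/K is real, the imaginary part of 1/(K + w) is already that of the difference 1/(K + w)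
  -- - 1/K.
  invIm-close : ℚ.∣ invIm (K ℚ.+ a) b ∣ ℚ.≤ 2ℚ ℚ.* r ℚ.* (invℚ η ℚ.* invℚ η) ℚ.* invℚ K
  invIm-close = quotient-bound (ℚ.- b) 0<η 1≤K (0≤p*q (ℚₚ.nonNegative⁻¹ 2ℚ) 0≤r)
    (subst (ℚ._≤ 2ℚ ℚ.* r ℚ.* K) (sym (ℚₚ.∣-p∣≡∣p∣ b))
      (ℚₚ.≤-trans ∣b∣≤r (ℚₚ.≤-trans r≤2r (s≤sK (ℚₚ.≤-trans 0≤r r≤2r))))) ηK²≤D

  -- Re 1/(K + w) − 1/K = − (a + (a² + b²)/K) / ∣K + w∣² for w = a + ib.
  invRe-close : ℚ.∣ invRe (K ℚ.+ a) b ℚ.- invℚ K ∣ ℚ.≤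
                2ℚ ℚ.* r ℚ.* (invℚ η ℚ.* invℚ η) ℚ.* invℚ K
  invRe-close = subst (λ d → ℚ.∣ d ∣ ℚ.≤ 2ℚ ℚ.* r ℚ.* (invℚ η ℚ.* invℚ η) ℚ.* κ) (sym identity)
    (quotient-bound (ℚ.- N) 0<η 1≤K (ℚₚ.≤-trans 0≤r r≤2r) (begin
      ℚ.∣ ℚ.- N ∣                              ≡⟨ ℚₚ.∣-p∣≡∣p∣ N ⟩
      ℚ.∣ N ∣                                  ≤⟨ ℚₚ.∣p+q∣≤∣p∣+∣q∣ a (normSq a b ℚ.* κ) ⟩
      ℚ.∣ a ∣ ℚ.+ ℚ.∣ normSq a b ℚ.* κ ∣       ≡⟨ cong (ℚ.∣ a ∣ ℚ.+_) (ℚₚ.0≤p⇒∣p∣≡p (0≤p*q 0≤ab 0≤κ)) ⟩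
      ℚ.∣ a ∣ ℚ.+ normSq a b ℚ.* κ             ≤⟨ ℚₚ.+-mono-≤ ∣a∣≤r (*-mono-≤ 0≤κ 0≤r ab≤r κ≤1) ⟩
      r ℚ.+ r ℚ.* 1ℚ                           ≡⟨ solve 1 (λ r → r :+ r :* con 1ℚ := con 2ℚ :* r) refl r ⟩
      2ℚ ℚ.* r                                 ≤⟨ s≤sK (ℚₚ.≤-trans 0≤r r≤2r) ⟩
      2ℚ ℚ.* r ℚ.* K                           ∎) ηK²≤D)
    where
    open ℚₚ.≤-Reasoning
    κ = invℚ K
    δ = invℚ D
    N = a ℚ.+ normSq a b ℚ.* κ
    0≤ab = 0≤p+q (0≤p² a) (0≤p² b)
    0≤κ = ℚₚ.<⇒≤ (invℚ-pos (1≤x⇒0<x 1≤K))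
    κ≤1 : κ ℚ.≤ 1ℚ
    κ≤1 = invℚ-anti (ℚₚ.positive⁻¹ 1ℚ) 1≤K
    ab≤r : normSq a b ℚ.≤ r
    ab≤r = ℚₚ.≤-trans ab≤r² (subst (r ℚ.* r ℚ.≤_) (ℚₚ.*-identityʳ r) (*-monoʳ-≤ r 0≤r r≤1))
    Kκ≡1 : K ℚ.* κ ≡ 1ℚ
    Kκ≡1 = invℚ-inverseʳ (1≤x⇒0<x 1≤K)
    Dδ≡1 : D ℚ.* δ ≡ 1ℚ
    Dδ≡1 = invℚ-inverseʳ 0<D
    identity : (K ℚ.+ a) ℚ.* δ ℚ.- κ ≡ (ℚ.- N) ℚ.* δ
    identity = begin-equality
      (K ℚ.+ a) ℚ.* δ ℚ.- κ
        ≡⟨ cong₂ ℚ._-_ (ℚₚ.*-identityʳ ((K ℚ.+ a) ℚ.* δ)) (ℚₚ.*-identityʳ κ) ⟨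
      (K ℚ.+ a) ℚ.* δ ℚ.* 1ℚ ℚ.- κ ℚ.* 1ℚ
        ≡⟨ cong₂ (λ d e → (K ℚ.+ a) ℚ.* δ ℚ.* d ℚ.- κ ℚ.* e) Kκ≡1 Dδ≡1 ⟨
      (K ℚ.+ a) ℚ.* δ ℚ.* (K ℚ.* κ) ℚ.- κ ℚ.* (D ℚ.* δ)
        ≡⟨ solve 5 (λ K a b κ δ →
             (K :+ a) :* δ :* (K :* κ) :- κ :* (((K :+ a) :* (K :+ a) :+ b :* b) :* δ) :=
             (:- (a :* (K :* κ) :+ (a :* a :+ b :* b) :* κ)) :* δ) refl K a b κ δ ⟩
      (ℚ.- (a ℚ.* (K ℚ.* κ) ℚ.+ normSq a b ℚ.* κ)) ℚ.* δ
        ≡⟨ cong (λ e → (ℚ.- (a ℚ.* e ℚ.+ normSq a b ℚ.* κ)) ℚ.* δ) Kκ≡1 ⟩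
      (ℚ.- (a ℚ.* 1ℚ ℚ.+ normSq a b ℚ.* κ)) ℚ.* δ
        ≡⟨ cong (λ e → (ℚ.- (e ℚ.+ normSq a b ℚ.* κ)) ℚ.* δ) (ℚₚ.*-identityʳ a) ⟩
      (ℚ.- N) ℚ.* δ ∎

-- Finite rational sums over lists.

∑ : {I : Set} → (I → ℚ) → List I → ℚ
∑ g []      = 0ℚ
∑ g (i ∷ L) = g i ℚ.+ ∑ g L

module _ {I : Set} where

  ∑-++ : ∀ (g : I → ℚ) L M → ∑ g (L ++ M) ≡ ∑ g L ℚ.+ ∑ g M
  ∑-++ g []      M = sym (ℚₚ.+-identityˡ (∑ g M))
  ∑-++ g (i ∷ L) M = trans (cong (g i ℚ.+_) (∑-++ g L M)) (sym (ℚₚ.+-assoc (g i) (∑ g L) (∑ g M)))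

  ∑-↭ : ∀ (g : I → ℚ) {L M} → L ↭ M → ∑ g L ≡ ∑ g M
  ∑-↭ g Perm.refl              = refl
  ∑-↭ g (Perm.prep i L↭M)      = cong (g i ℚ.+_) (∑-↭ g L↭M)
  ∑-↭ g (Perm.swap {L} {M} i j L↭M) = trans
    (solve 3 (λ a b s → a :+ (b :+ s) := b :+ (a :+ s)) refl (g i) (g j) (∑ g L))
    (cong (λ s → g j ℚ.+ (g i ℚ.+ s)) (∑-↭ g L↭M))
  ∑-↭ g (Perm.trans L↭M M↭N)   = trans (∑-↭ g L↭M) (∑-↭ g M↭N)

  ∣∑∣≤∑ : ∀ {g c : I → ℚ} → (∀ i → ℚ.∣ g i ∣ ℚ.≤ c i) → ∀ L → ℚ.∣ ∑ g L ∣ ℚ.≤ ∑ c L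
  ∣∑∣≤∑ g≤c []          = ℚₚ.≤-refl
  ∣∑∣≤∑ {g} g≤c (i ∷ L) = ℚₚ.≤-trans (ℚₚ.∣p+q∣≤∣p∣+∣q∣ (g i) (∑ g L)) (ℚₚ.+-mono-≤ (g≤c i) (∣∑∣≤∑ g≤c L))

  -- The entries of `L` are moved to the front of `M` one at a time. As `L` has no duplicates,
  -- removing one of them from `M` leaves the later ones in place.
  complement : ∀ {L M : List I} → Unique L → L ⊆ M → ∃ λ R → M ↭ L ++ R
  complement {[]}    {M} _ _ = M , Perm.refl
  complement {i ∷ L} (i∉L ∷ L!) iL⊆M with ∈-∃++ (iL⊆M (here refl))
  ... | M₁ , M₂ , refl = R , ↭-trans M↭iM′ (↭-prep i M′↭LR)
    where
    M↭iM′ = shift i M₁ M₂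
    L⊆M′ : L ⊆ M₁ ++ M₂
    L⊆M′ j∈L with ∈-resp-↭ M↭iM′ (iL⊆M (there j∈L))
    ... | here  j≡i  = contradiction (sym j≡i) (All.lookup i∉L j∈L)
    ... | there j∈M′ = j∈M′
    R      = proj₁ (complement L! L⊆M′)
    M′↭LR = proj₂ (complement L! L⊆M′)

  -- Both differences reduce, up to sign, to sums over the same complement of `L` in `M`, where the
  -- termwise bound applies.
  ∑-complement-bound : ∀ {g c : I → ℚ} → (∀ i → ℚ.∣ g i ∣ ℚ.≤ c i) →
    ∀ {L M} → Unique L → L ⊆ M → ℚ.∣ ∑ g L ℚ.- ∑ g M ∣ ℚ.≤ ∑ c M ℚ.- ∑ c L
  ∑-complement-bound {g} {c} g≤c {L} {M} L! L⊆M with complement L! L⊆M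
  ... | R , M↭LR = subst₂ (λ d e → ℚ.∣ d ∣ ℚ.≤ e)
    (trans (solve 2 (λ l r → :- r := l :- (l :+ r)) refl (∑ g L) (∑ g R)) (cong (λ s → ∑ g L ℚ.- s) (sym (split g))))
    (trans (solve 2 (λ l r → r := (l :+ r) :- l) refl (∑ c L) (∑ c R)) (cong (ℚ._- ∑ c L) (sym (split c))))
    (subst (ℚ._≤ ∑ c R) (sym (ℚₚ.∣-p∣≡∣p∣ (∑ g R))) (∣∑∣≤∑ g≤c R))
    where
    split : ∀ h → ∑ h M ≡ ∑ h L ℚ.+ ∑ h R
    split h = trans (∑-↭ h M↭LR) (∑-++ h L R)

  -- Nonnegativity of `c` enters through `g`: the difference of the two sums dominates an absolute
  -- value.
  ∑-mono-⊆ : ∀ {g c : I → ℚ} → (∀ i → ℚ.∣ g i ∣ ℚ.≤ c i) → ∀ {L M} → Unique L → L ⊆ M → ∑ c L ℚ.≤ ∑ c M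
  ∑-mono-⊆ {g} {c} g≤c {L} {M} L! L⊆M = ≤-by (∑ c M ℚ.- ∑ c L)
    (ℚₚ.≤-trans (ℚₚ.0≤∣p∣ (∑ g L ℚ.- ∑ g M)) (∑-complement-bound g≤c L! L⊆M))
    (solve 2 (λ l m → l :+ (m :- l) := m) refl (∑ c L) (∑ c M))

  ∑-cauchy : ∀ (f : I → ℝ) L → IsCauchy (λ n → ∑ (λ i → seq (f i) n) L)
  ∑-cauchy f []      = cauchy (fromℚʳ 0ℚ)
  ∑-cauchy f (i ∷ L) = cauchy (f i +ʳ mkℝ _ (∑-cauchy f L))

  seq-re-sum : ∀ (f : I → ℂ) L n → seq (re (sum (map f L))) n ≡ ∑ (λ i → seq (re (f i)) n) L
  seq-re-sum f []      n = refl
  seq-re-sum f (i ∷ L) n = cong (seq (re (f i)) n ℚ.+_) (seq-re-sum f L n)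

  seq-im-sum : ∀ (f : I → ℂ) L n → seq (im (sum (map f L))) n ≡ ∑ (λ i → seq (im (f i)) n) L
  seq-im-sum f []      n = refl
  seq-im-sum f (i ∷ L) n = cong (seq (im (f i)) n ℚ.+_) (seq-im-sum f L n)

-- Convergence of unordered sums under a telescoping majorant.

record Exhaustion (I : Set) : Set where
  field
    stage      : ℕ → List I
    unique     : ∀ n → Unique (stage n)
    increasing : ∀ n → stage n ⊆ stage (suc n)
    covers     : ∀ i → ∃ λ n → i ∈ stage n

  stage-mono : ∀ {m n} → m ℕ.≤ n → stage m ⊆ stage n
  stage-mono {m} m≤n = go (ℕₚ.≤⇒≤′ m≤n)
    where
    go : ∀ {n} → m ℕ.≤′ n → stage m ⊆ stage n
    go ℕ.≤′-refl            = λ i∈ → i∈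
    go (ℕ.≤′-step {n} m≤′n) = increasing n ∘ go m≤′n

  covers-list : ∀ L → ∃ λ n → L ⊆ stage n
  covers-list []      = 0 , λ ()
  covers-list (i ∷ L) =
    let m , i∈ = covers i
        n , L⊆ = covers-list L
    in m ℕ.⊔ n , λ { (here refl) → stage-mono (ℕₚ.m≤m⊔n m n) i∈
                   ; (there j∈)  → stage-mono (ℕₚ.m≤n⊔m m n) (L⊆ j∈) }

-- Two squares of ε/2 use up only ε²/2; the other half of ε² is the positive gap that the strict
-- order demands.
∣∣<-intro : ∀ w {ε} → 0ℚ ℚ.< ε →
  (∃ λ N → ∀ n → N ℕ.≤ n → ℚ.∣ seq (re w) n ∣ ℚ.≤ ½ ℚ.* ε × ℚ.∣ seq (im w) n ∣ ℚ.≤ ½ ℚ.* ε) → ∣ w ∣< ε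
∣∣<-intro w {ε} 0<ε (N , small) = ½ ℚ.* (ε ℚ.* ε) , 0<p*q (ℚₚ.positive⁻¹ ½) (0<p*q 0<ε 0<ε) , N , λ n N≤n →
  let a = seq (re w) n
      b = seq (im w) n
      h = ½ ℚ.* ε
      open ℚₚ.≤-Reasoning
  in begin
    normSq a b ℚ.+ ½ ℚ.* (ε ℚ.* ε)
      ≤⟨ ℚₚ.+-monoˡ-≤ (½ ℚ.* (ε ℚ.* ε)) (ℚₚ.+-mono-≤
           (∣p∣≤r⇒p²≤r² a (proj₁ (small n N≤n))) (∣p∣≤r⇒p²≤r² b (proj₂ (small n N≤n)))) ⟩
    (h ℚ.* h ℚ.+ h ℚ.* h) ℚ.+ ½ ℚ.* (ε ℚ.* ε)
      ≡⟨ solve 1 (λ e → (con ½ :* e :* (con ½ :* e) :+ con ½ :* e :* (con ½ :* e)) :+ con ½ :* (e :* e) := e :* e) refl ε ⟩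
    ε ℚ.* ε ∎

-- The bounds are rational and hold from a single `onset` for all indices i, as the diagonal
-- requires. `growth` lets each stage add at most a multiple of one telescoping step, which turns
-- the majorant into an explicit tail estimate.
record Majorant {I : Set} (E : Exhaustion I) (f : I → ℂ) : Set where
  open Exhaustion E
  field
    bound    : I → ℚ
    onset    : ℕ
    re≤bound : ∀ n → onset ℕ.≤ n → ∀ i → ℚ.∣ seq (re (f i)) n ∣ ℚ.≤ bound i
    im≤bound : ∀ n → onset ℕ.≤ n → ∀ i → ℚ.∣ seq (im (f i)) n ∣ ℚ.≤ bound i
    scale    : ℚ
    0≤scale  : 0ℚ ℚ.≤ scale
    growth   : ∀ j → ∑ bound (stage (suc j)) ℚ.≤ ∑ bound (stage j) ℚ.+ scale ℚ.* gap j

  growth-from : ∀ {k n} → k ℕ.≤ n →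
    ∑ bound (stage n) ℚ.- ∑ bound (stage k) ℚ.≤ scale ℚ.* (recipℕ k ℚ.- recipℕ n)
  growth-from {k} k≤n = go (ℕₚ.≤⇒≤′ k≤n)
    where
    go : ∀ {n} → k ℕ.≤′ n → ∑ bound (stage n) ℚ.- ∑ bound (stage k) ℚ.≤ scale ℚ.* (recipℕ k ℚ.- recipℕ n)
    go ℕ.≤′-refl = ℚₚ.≤-reflexive (solve 3 (λ b s t → b :- b := s :* (t :- t)) refl
      (∑ bound (stage k)) scale (recipℕ k))
    go (ℕ.≤′-step {n} k≤′n) = begin
      ∑ bound (stage (suc n)) ℚ.- b
        ≤⟨ ℚₚ.+-monoˡ-≤ (ℚ.- b) (growth n) ⟩
      ∑ bound (stage n) ℚ.+ scale ℚ.* gap n ℚ.- b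
        ≡⟨ solve 3 (λ x y b → x :+ y :- b := (x :- b) :+ y) refl (∑ bound (stage n)) (scale ℚ.* gap n) b ⟩
      (∑ bound (stage n) ℚ.- b) ℚ.+ scale ℚ.* gap n
        ≤⟨ ℚₚ.+-monoˡ-≤ (scale ℚ.* gap n) (go k≤′n) ⟩
      scale ℚ.* (recipℕ k ℚ.- recipℕ n) ℚ.+ scale ℚ.* gap n
        ≡⟨ solve 4 (λ s t u v → s :* (t :- u) :+ s :* (u :- v) := s :* (t :- v)) refl
             scale (recipℕ k) (recipℕ n) (recipℕ (suc n)) ⟩
      scale ℚ.* (recipℕ k ℚ.- recipℕ (suc n)) ∎
      where
      open ℚₚ.≤-Reasoning
      b = ∑ bound (stage k)

  tail-bound : ∀ {ε} → 0ℚ ℚ.< ε → ∃ λ k → ∀ n → k ℕ.≤ n → ∑ bound (stage n) ℚ.- ∑ bound (stage k) ℚ.≤ ε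
  tail-bound {ε} 0<ε =
    let k , small = recipℕ-null scale 0<ε
        open ℚₚ.≤-Reasoning
    in k , λ n k≤n → begin
      ∑ bound (stage n) ℚ.- ∑ bound (stage k)        ≤⟨ growth-from k≤n ⟩
      scale ℚ.* (recipℕ k ℚ.- recipℕ n)              ≤⟨ ≤-by (scale ℚ.* recipℕ n) (0≤p*q 0≤scale (0≤recipℕ n))
                                                          (solve 3 (λ s t u → s :* (t :- u) :+ s :* u := s :* t) refl
                                                            scale (recipℕ k) (recipℕ n)) ⟩
      scale ℚ.* recipℕ k                             ≤⟨ ℚₚ.<⇒≤ small ⟩
      ε                                              ∎

  module _ (g : I → ℝ) (g≤bound : ∀ n → onset ℕ.≤ n → ∀ i → ℚ.∣ seq (g i) n ∣ ℚ.≤ bound i) where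

    private
      at : ℕ → I → ℚ
      at n i = seq (g i) n

    -- What `stage n` has beyond `L` weighs at most what it has beyond `stage k`. The case of
    -- `stage k` itself makes the diagonal Cauchy; an arbitrary `L` gives `hasSum`.
    partial-close : ∀ {k n L} → onset ℕ.≤ n → Unique L → stage k ⊆ L → L ⊆ stage n →
      ℚ.∣ ∑ (at n) L ℚ.- ∑ (at n) (stage n) ∣ ℚ.≤ ∑ bound (stage n) ℚ.- ∑ bound (stage k)
    partial-close {k} {n} onset≤n L! k⊆L L⊆n = ℚₚ.≤-trans
      (∑-complement-bound (g≤bound n onset≤n) L! L⊆n)
      (ℚₚ.+-monoʳ-≤ (∑ bound (stage n)) (ℚₚ.neg-antimono-≤ (∑-mono-⊆ (g≤bound n onset≤n) (unique k) k⊆L)))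

    diagonal-cauchy : IsCauchy (λ n → ∑ (at n) (stage n))
    diagonal-cauchy ε 0<ε =
      -- Passing through the fixed stage k costs three errors of at most ε/4 each: the tail at index
      -- m, the Cauchy error of the finite sum, and the tail at index n.
      let 0<¼ = ℚₚ.positive⁻¹ (½ ℚ.* ½)
          δ   = ½ ℚ.* ½ ℚ.* ε
          0<δ = 0<p*q 0<¼ 0<ε
          k , tail = tail-bound 0<δ
          N , near = ∑-cauchy g (stage k) δ 0<δ
          open ℚₚ.≤-Reasoning
      in (onset ℕ.⊔ k) ℕ.⊔ N , λ m n l≤m l≤n →
        let sk≤m = ℕₚ.m⊔n≤o⇒m≤o (onset ℕ.⊔ k) N l≤m
            sk≤n = ℕₚ.m⊔n≤o⇒m≤o (onset ℕ.⊔ k) N l≤n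
            k≤m  = ℕₚ.m⊔n≤o⇒n≤o onset k sk≤m
            k≤n  = ℕₚ.m⊔n≤o⇒n≤o onset k sk≤n
            Sm = ∑ (at m) (stage m)
            Sn = ∑ (at n) (stage n)
            Pm = ∑ (at m) (stage k)
            Pn = ∑ (at n) (stage k)
        in begin-strict
          ℚ.∣ Sm ℚ.- Sn ∣
            ≤⟨ ∣p-q∣-triangle Sm Pm Sn ⟩
          ℚ.∣ Sm ℚ.- Pm ∣ ℚ.+ ℚ.∣ Pm ℚ.- Sn ∣
            ≤⟨ ℚₚ.+-mono-≤ (ℚₚ.≤-reflexive (∣p-q∣-comm Sm Pm)) (∣p-q∣-triangle Pm Pn Sn) ⟩
          ℚ.∣ Pm ℚ.- Sm ∣ ℚ.+ (ℚ.∣ Pm ℚ.- Pn ∣ ℚ.+ ℚ.∣ Pn ℚ.- Sn ∣)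
            <⟨ ℚₚ.+-mono-≤-<
                 (ℚₚ.≤-trans (partial-close (ℕₚ.m⊔n≤o⇒m≤o onset k sk≤m) (unique k) (λ i∈ → i∈) (stage-mono k≤m)) (tail m k≤m))
                 (ℚₚ.+-mono-<-≤ (near m n (ℕₚ.m⊔n≤o⇒n≤o (onset ℕ.⊔ k) N l≤m) (ℕₚ.m⊔n≤o⇒n≤o (onset ℕ.⊔ k) N l≤n))
                 (ℚₚ.≤-trans (partial-close (ℕₚ.m⊔n≤o⇒m≤o onset k sk≤n) (unique k) (λ i∈ → i∈) (stage-mono k≤n)) (tail n k≤n))) ⟩
          δ ℚ.+ (δ ℚ.+ δ)
            ≤⟨ ≤-by δ (ℚₚ.<⇒≤ 0<δ) (solve 1 (λ e → con ½ :* con ½ :* e :+ (con ½ :* con ½ :* e :+ con ½ :* con ½ :* e)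
                 :+ con ½ :* con ½ :* e := e) refl ε) ⟩
          ε ∎

  -- The n-th rational approximation of the sum uses stage n and the n-th
  -- approximations of the terms.
  limit : ℂ
  limit = mkℝ _ (diagonal-cauchy (re ∘ f) re≤bound) +i mkℝ _ (diagonal-cauchy (im ∘ f) im≤bound)

  -- For large n the finite list `T` lies between `stage k` and `stage n`, and `stage n` is the one
  -- that `limit` uses at index n.
  hasSum : HasSum f limit
  hasSum ε 0<ε =
    let k , tail = tail-bound (0<p*q (ℚₚ.positive⁻¹ ½) 0<ε)
    in stage k , λ T T! k⊆T →
      let m , T⊆m = covers-list T
      in ∣∣<-intro (sum (map f T) - limit) 0<ε ((onset ℕ.⊔ k) ℕ.⊔ m , λ n l≤n →
        let sk≤n = ℕₚ.m⊔n≤o⇒m≤o (onset ℕ.⊔ k) m l≤n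
            onset≤n = ℕₚ.m⊔n≤o⇒m≤o onset k sk≤n
            tail≤ = tail n (ℕₚ.m⊔n≤o⇒n≤o onset k sk≤n)
            T⊆n : T ⊆ stage n
            T⊆n = stage-mono (ℕₚ.m⊔n≤o⇒n≤o (onset ℕ.⊔ k) m l≤n) ∘ T⊆m
        in subst (λ s → ℚ.∣ s ℚ.- seq (re limit) n ∣ ℚ.≤ ½ ℚ.* ε) (sym (seq-re-sum f T n))
             (ℚₚ.≤-trans (partial-close (re ∘ f) re≤bound onset≤n T! k⊆T T⊆n) tail≤)
         , subst (λ s → ℚ.∣ s ℚ.- seq (im limit) n ∣ ℚ.≤ ½ ℚ.* ε) (sym (seq-im-sum f T n))
             (ℚₚ.≤-trans (partial-close (im ∘ f) im≤bound onset≤n T! k⊆T T⊆n) tail≤))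

-- Powers of complex numbers at the level of approximations.

-- The two-square identity |zw|² = |z|²|w|² is polynomial, so it holds exactly at each index and not
-- merely in the limit.
seq-∣^∣² : ∀ z m n → seq ∣ z ^ m ∣² n ≡ seq ∣ z ∣² n ^ℚ m
seq-∣^∣² z zero    n = refl
seq-∣^∣² z (suc m) n = trans
  (solve 4 (λ a b c d →
     (a :* c :+ :- (b :* d)) :* (a :* c :+ :- (b :* d)) :+ (a :* d :+ b :* c) :* (a :* d :+ b :* c) :=
     (a :* a :+ b :* b) :* (c :* c :+ d :* d))
     refl (seq (re z) n) (seq (im z) n) (seq (re (z ^ m)) n) (seq (im (z ^ m)) n))
  (cong (seq ∣ z ∣² n ℚ.*_) (seq-∣^∣² z m n))

0≤∣∣² : ∀ z n → 0ℚ ℚ.≤ seq ∣ z ∣² n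
0≤∣∣² z n = 0≤p+q (0≤p² (seq (re z) n)) (0≤p² (seq (im z) n))

∣^∣²≤∣∣² : ∀ z {m} n → 1 ℕ.≤ m → seq ∣ z ∣² n ℚ.≤ 1ℚ → seq ∣ z ^ m ∣² n ℚ.≤ seq ∣ z ∣² n
∣^∣²≤∣∣² z {m} n 1≤m ∣z∣²≤1 =
  subst (ℚ._≤ seq ∣ z ∣² n) (sym (seq-∣^∣² z m n)) (x^m≤x 1≤m (0≤∣∣² z n) ∣z∣²≤1)

seq-fromℚ-^ : ∀ q m n → seq (re (fromℚ q ^ m)) n ≡ q ^ℚ m × seq (im (fromℚ q ^ m)) n ≡ 0ℚ
seq-fromℚ-^ q zero    n = refl , refl
seq-fromℚ-^ q (suc m) n =
  let re≡ , im≡ = seq-fromℚ-^ q m n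
  in trans (cong₂ (λ x y → q ℚ.* x ℚ.+ ℚ.- (0ℚ ℚ.* y)) re≡ im≡)
       (solve 2 (λ q x → q :* x :+ :- (con 0ℚ :* con 0ℚ) := q :* x) refl q (q ^ℚ m))
   , trans (cong₂ (λ x y → q ℚ.* y ℚ.+ 0ℚ ℚ.* x) re≡ im≡)
       (solve 2 (λ q x → q :* con 0ℚ :+ con 0ℚ :* x := con 0ℚ) refl q (q ^ℚ m))

-- Exhaustions of the naturals and the integers.

ℕ-exhaustion : Exhaustion ℕ
ℕ-exhaustion = record
  { stage = downFrom ; unique = downFrom⁺ ; increasing = λ _ → there ; covers = λ i → suc i , here refl }

-- Kept in step with `downFrom`: the stage that adds n + 1 and -(n + 1) here adds the index n there,
-- whose zeta term is 1/(n + 1)ᵐ.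
symmetricRange : ℕ → List ℤ
symmetricRange zero    = + 0 ∷ []
symmetricRange (suc n) = + suc n ∷ -[1+ n ] ∷ symmetricRange n

symmetricRange-bounded : ∀ n → All (λ k → ℤ.∣ k ∣ ℕ.≤ n) (symmetricRange n)
symmetricRange-bounded zero    = ℕ.z≤n ∷ []
symmetricRange-bounded (suc n) =
  ℕₚ.≤-refl ∷ ℕₚ.≤-refl ∷ All.map ℕₚ.m≤n⇒m≤1+n (symmetricRange-bounded n)

symmetricRange-unique : ∀ n → Unique (symmetricRange n)
symmetricRange-unique zero    = [] ∷ []
symmetricRange-unique (suc n) =
  ((λ ()) ∷ fresh (+ suc n) refl) ∷ fresh -[1+ n ] refl ∷ symmetricRange-unique n
  where
  fresh : ∀ k → ℤ.∣ k ∣ ≡ suc n → All (k ≢_) (symmetricRange n)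
  fresh k ∣k∣≡ = All.map (λ ∣i∣≤n k≡i → ℕₚ.1+n≰n (subst (ℕ._≤ n) (trans (cong ℤ.∣_∣ (sym k≡i)) ∣k∣≡) ∣i∣≤n))
    (symmetricRange-bounded n)

ℤ-exhaustion : Exhaustion ℤ
ℤ-exhaustion = record
  { stage = symmetricRange ; unique = symmetricRange-unique ; increasing = λ _ → there ∘ there ; covers = covers }
  where
  covers : ∀ k → ∃ λ n → k ∈ symmetricRange n
  covers (+ zero)    = 0 , here refl
  covers (+ suc n)   = suc n , here refl
  covers -[1+ n ]    = suc n , there (here refl)

-- Each new pair ±(j + 1) contributes an error of at most 4s · `gap j`, and the gaps sum to less
-- than 1.
∑-symmetric-close : ∀ (g : ℤ → ℚ) (h : ℕ → ℚ) {s} → 0ℚ ℚ.≤ s →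
  (∀ k j → ℤ.∣ k ∣ ≡ suc j → ℚ.∣ g k ℚ.- h j ∣ ℚ.≤ s ℚ.* (gap j ℚ.+ gap j)) → ∀ n →
  ℚ.∣ ∑ g (symmetricRange n) ℚ.- g (+ 0) ℚ.- (∑ h (downFrom n) ℚ.+ ∑ h (downFrom n)) ∣ ℚ.≤
  2ℚ ℚ.* 2ℚ ℚ.* s
∑-symmetric-close g h {s} 0≤s close n = begin
  ℚ.∣ ∑ g (symmetricRange n) ℚ.- g (+ 0) ℚ.- (∑ h (downFrom n) ℚ.+ ∑ h (downFrom n)) ∣  ≤⟨ telescope n ⟩
  2ℚ ℚ.* 2ℚ ℚ.* s ℚ.* (1ℚ ℚ.- recipℕ n)
    ≤⟨ ≤-by (2ℚ ℚ.* 2ℚ ℚ.* s ℚ.* recipℕ n)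
         (0≤p*q (0≤p*q (ℚₚ.nonNegative⁻¹ (2ℚ ℚ.* 2ℚ)) 0≤s) (0≤recipℕ n))
         (solve 2 (λ s t → s :* (con 1ℚ :- t) :+ s :* t := s) refl (2ℚ ℚ.* 2ℚ ℚ.* s) (recipℕ n)) ⟩
  2ℚ ℚ.* 2ℚ ℚ.* s ∎
  where
  open ℚₚ.≤-Reasoning
  -- The induction needs the exact telescoped value 4s(1 - 1/(n + 1)), which vanishes at n = 0,
  -- where only the term at k = 0 is present and cancels.
  telescope : ∀ n →
    ℚ.∣ ∑ g (symmetricRange n) ℚ.- g (+ 0) ℚ.- (∑ h (downFrom n) ℚ.+ ∑ h (downFrom n)) ∣ ℚ.≤
    2ℚ ℚ.* 2ℚ ℚ.* s ℚ.* (1ℚ ℚ.- recipℕ n)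
  telescope zero = ℚₚ.≤-reflexive (trans
    (cong ℚ.∣_∣ (solve 1 (λ x → x :+ con 0ℚ :- x :- (con 0ℚ :+ con 0ℚ) := con 0ℚ) refl (g (+ 0))))
    (sym (ℚₚ.*-zeroʳ (2ℚ ℚ.* 2ℚ ℚ.* s))))
  telescope (suc n) = begin
    ℚ.∣ (p ℚ.+ (q ℚ.+ G)) ℚ.- g₀ ℚ.- ((x ℚ.+ H) ℚ.+ (x ℚ.+ H)) ∣
      ≡⟨ cong ℚ.∣_∣ (solve 6 (λ p q G g₀ x H →
           (p :+ (q :+ G)) :- g₀ :- ((x :+ H) :+ (x :+ H)) :=
           (p :- x) :+ ((q :- x) :+ (G :- g₀ :- (H :+ H)))) refl p q G g₀ x H) ⟩
    ℚ.∣ (p ℚ.- x) ℚ.+ ((q ℚ.- x) ℚ.+ (G ℚ.- g₀ ℚ.- (H ℚ.+ H))) ∣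
      ≤⟨ ℚₚ.∣p+q∣≤∣p∣+∣q∣ (p ℚ.- x) ((q ℚ.- x) ℚ.+ (G ℚ.- g₀ ℚ.- (H ℚ.+ H))) ⟩
    ℚ.∣ p ℚ.- x ∣ ℚ.+ ℚ.∣ (q ℚ.- x) ℚ.+ (G ℚ.- g₀ ℚ.- (H ℚ.+ H)) ∣
      ≤⟨ ℚₚ.+-mono-≤ (close (+ suc n) n refl) (ℚₚ.≤-trans
           (ℚₚ.∣p+q∣≤∣p∣+∣q∣ (q ℚ.- x) (G ℚ.- g₀ ℚ.- (H ℚ.+ H)))
           (ℚₚ.+-mono-≤ (close -[1+ n ] n refl) (telescope n))) ⟩
    s ℚ.* (gap n ℚ.+ gap n) ℚ.+ (s ℚ.* (gap n ℚ.+ gap n) ℚ.+ 2ℚ ℚ.* 2ℚ ℚ.* s ℚ.* (1ℚ ℚ.- recipℕ n))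
      ≡⟨ solve 3 (λ s t u →
           s :* ((t :- u) :+ (t :- u)) :+ (s :* ((t :- u) :+ (t :- u)) :+ con 2ℚ :* con 2ℚ :* s :* (con 1ℚ :- t)) :=
           con 2ℚ :* con 2ℚ :* s :* (con 1ℚ :- u)) refl s (recipℕ n) (recipℕ (suc n)) ⟩
    2ℚ ℚ.* 2ℚ ℚ.* s ℚ.* (1ℚ ℚ.- recipℕ (suc n)) ∎
    where
    p = g (+ suc n) ; q = g -[1+ n ] ; g₀ = g (+ 0) ; x = h n
    G = ∑ g (symmetricRange n) ; H = ∑ h (downFrom n)

-- The series for ζ(m) and U(z) at a fixed exponent.

module _ (m : ℕ) (2≤m : 2 ℕ.≤ m) where

  private
    1≤m : 1 ℕ.≤ m
    1≤m = ℕₚ.≤-trans (ℕ.s≤s ℕ.z≤n) 2≤m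

  powℕ : ℕ → ℚ
  powℕ j = fromℕ (suc j) ^ℚ m

  1≤powℕ : ∀ j → 1ℚ ℚ.≤ powℕ j
  1≤powℕ j = 1≤x^m m (1≤fromℕ-suc j)

  0≤1/powℕ : ∀ j → 0ℚ ℚ.≤ invℚ (powℕ j)
  0≤1/powℕ j = ℚₚ.<⇒≤ (invℚ-pos (1≤x⇒0<x (1≤powℕ j)))

  1/powℕ≤2gap : ∀ j → invℚ (powℕ j) ℚ.≤ gap j ℚ.+ gap j
  1/powℕ≤2gap j = ℚₚ.≤-trans
    (subst (invℚ (powℕ j) ℚ.≤_) (invℚ-* (0<fromℕ-suc j) (0<fromℕ-suc j))
      (invℚ-anti (0<p*q (0<fromℕ-suc j) (0<fromℕ-suc j)) (x²≤x^m 2≤m (1≤fromℕ-suc j))))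
    (recipℕ²≤2gap j)

  zetaTerm : ℕ → ℂ
  zetaTerm k = fromℚ (ℚ._/_ (ℤ.+ 1) (suc k ℕ.^ m) {{ℕₚ.m^n≢0 (suc k) m}})

  zetaTerm-re : ∀ k n → seq (re (zetaTerm k)) n ≡ invℚ (powℕ k)
  zetaTerm-re k n = trans (1/d≡invℚ (suc k ℕ.^ m) {{ℕₚ.m^n≢0 (suc k) m}}) (cong invℚ (fromℕ-^ (suc k) m))

  zeta-majorant : Majorant ℕ-exhaustion zetaTerm
  zeta-majorant = record
    { bound    = invℚ ∘ powℕ
    ; onset    = 0
    ; re≤bound = λ n _ j → ℚₚ.≤-reflexive (trans (cong ℚ.∣_∣ (zetaTerm-re j n)) (ℚₚ.0≤p⇒∣p∣≡p (0≤1/powℕ j)))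
    ; im≤bound = λ n _ j → 0≤1/powℕ j
    ; scale    = 2ℚ
    ; 0≤scale  = ℚₚ.nonNegative⁻¹ 2ℚ
    ; growth   = λ j → let S = ∑ (invℚ ∘ powℕ) (downFrom j) in subst (invℚ (powℕ j) ℚ.+ S ℚ.≤_)
        (solve 2 (λ S g → (g :+ g) :+ S := S :+ con 2ℚ :* g) refl S (gap j))
        (ℚₚ.+-monoˡ-≤ S (1/powℕ≤2gap j))
    }

  zeta : ℂ
  zeta = Majorant.limit zeta-majorant

  module _ (even : ∀ x → (ℚ.- x) ^ℚ m ≡ x ^ℚ m) (z : ℂ) where

    private
      w : ℂ
      w = pow ℂ-rawSemiring z m

      a b : ℕ → ℚ
      a n = seq (re w) n
      b n = seq (im w) n

    fromℤ-^-re : ∀ k {j} → ℤ.∣ k ∣ ≡ suc j → ∀ n → seq (re (fromℤ k ^ m)) n ≡ powℕ j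
    fromℤ-^-re (+ suc j) refl n = proj₁ (seq-fromℚ-^ (+ suc j ℚ./ 1) m n)
    -- `-[1+ j ] ℚ./ 1` computes to the negative of `fromℕ (suc j)`, so parity removes the sign.
    fromℤ-^-re -[1+ j ]  refl n = trans (proj₁ (seq-fromℚ-^ (-[1+ j ] ℚ./ 1) m n)) (even (fromℕ (suc j)))

    fromℤ-^-0 : ∀ n → seq (re (fromℤ (+ 0) ^ m)) n ≡ 0ℚ
    fromℤ-^-0 n = trans (proj₁ (seq-fromℚ-^ 0ℚ m n)) (0^m m 1≤m)
      where
      0^m : ∀ m → 1 ℕ.≤ m → 0ℚ ^ℚ m ≡ 0ℚ
      0^m (suc m) _ = ℚₚ.*-zeroˡ (0ℚ ^ℚ m)

    denominator-re : ∀ k {j} → ℤ.∣ k ∣ ≡ suc j → ∀ n → seq (re (pow ℂ-rawSemiring (fromℤ k) m + pow ℂ-rawSemiring z m)) n ≡ powℕ j ℚ.+ a n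
    denominator-re k ∣k∣≡ n = cong (ℚ._+ a n) (fromℤ-^-re k ∣k∣≡ n)

    denominator-im : ∀ k n → seq (im (pow ℂ-rawSemiring (fromℤ k) m + pow ℂ-rawSemiring z m)) n ≡ b n
    denominator-im k n = trans (cong (ℚ._+ b n) (proj₂ (seq-fromℚ-^ (k ℚ./ 1) m n))) (ℚₚ.+-identityˡ (b n))

    denominator-re-0 : ∀ n → seq (re (pow ℂ-rawSemiring (fromℤ (+ 0)) m + pow ℂ-rawSemiring z m)) n ≡ a n
    denominator-re-0 n = trans (cong (ℚ._+ a n) (fromℤ-^-0 n)) (ℚₚ.+-identityˡ (a n))

    module _ {η r : ℚ} (0<η : 0ℚ ℚ.< η) (0≤r : 0ℚ ℚ.≤ r) (r+η≤1 : r ℚ.+ η ℚ.≤ 1ℚ)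
             {N : ℕ} (∣w∣²≤r² : ∀ n → N ℕ.≤ n → normSq (a n) (b n) ℚ.≤ r ℚ.* r) where

      -- At k = 0 the denominator is 0ᵐ + w and inherits the gap of w; at every k ≠ 0 the gap is η².
      denominator-nonZero : NonZero w → ∀ k → NonZero (pow ℂ-rawSemiring (fromℤ k) m + pow ℂ-rawSemiring z m)
      denominator-nonZero (ε , 0<ε , M , ε≤) (+ zero) = ε , 0<ε , M , λ n M≤n →
        subst (0ℚ ℚ.+ ε ℚ.≤_) (cong₂ normSq (sym (denominator-re-0 n)) (sym (denominator-im (+ 0) n))) (ε≤ n M≤n)
      denominator-nonZero _ k@(+ suc j) = η ℚ.* η , 0<p*q 0<η 0<η , N , λ n N≤n →
        subst₂ ℚ._≤_ (sym (ℚₚ.+-identityˡ (η ℚ.* η)))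
          (cong₂ normSq (sym (denominator-re k refl n)) (sym (denominator-im k n)))
          (η²≤D (a n) (b n) 0<η (1≤powℕ j) 0≤r r+η≤1 (∣w∣²≤r² n N≤n))
      denominator-nonZero _ k@(-[1+ j ]) = η ℚ.* η , 0<p*q 0<η 0<η , N , λ n N≤n →
        subst₂ ℚ._≤_ (sym (ℚₚ.+-identityˡ (η ℚ.* η)))
          (cong₂ normSq (sym (denominator-re k refl n)) (sym (denominator-im k n)))
          (η²≤D (a n) (b n) 0<η (1≤powℕ j) 0≤r r+η≤1 (∣w∣²≤r² n N≤n))

    module _ (d≢0 : ∀ k → NonZero (pow ℂ-rawSemiring (fromℤ k) m + pow ℂ-rawSemiring z m)) where

      -- The proof `d≢0` stays arbitrary: it does not affect the approximations, so estimates with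
      -- different η and r apply to the same terms.
      term : ℤ → ℂ
      term k = recip (pow ℂ-rawSemiring (fromℤ k) m + pow ℂ-rawSemiring z m) (d≢0 k)

      term-re : ∀ k {j} → ℤ.∣ k ∣ ≡ suc j → ∀ n → seq (re (term k)) n ≡ invRe (powℕ j ℚ.+ a n) (b n)
      term-re k ∣k∣≡ n = cong₂ invRe (denominator-re k ∣k∣≡ n) (denominator-im k n)

      term-im : ∀ k {j} → ℤ.∣ k ∣ ≡ suc j → ∀ n → seq (im (term k)) n ≡ invIm (powℕ j ℚ.+ a n) (b n)
      term-im k ∣k∣≡ n = cong₂ invIm (denominator-re k ∣k∣≡ n) (denominator-im k n)

      module _ {η r : ℚ} (0<η : 0ℚ ℚ.< η) (0≤r : 0ℚ ℚ.≤ r) (r+η≤1 : r ℚ.+ η ℚ.≤ 1ℚ)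
               {N : ℕ} (∣w∣²≤r² : ∀ n → N ℕ.≤ n → normSq (a n) (b n) ℚ.≤ r ℚ.* r) where

        private
          A = 2ℚ ℚ.* (invℚ η ℚ.* invℚ η)

          0≤i² : 0ℚ ℚ.≤ invℚ η ℚ.* invℚ η
          0≤i² = 0≤p² (invℚ η)

          0≤A : 0ℚ ℚ.≤ A
          0≤A = 0≤p*q (ℚₚ.nonNegative⁻¹ 2ℚ) 0≤i²

        U-majorant : Majorant ℤ-exhaustion (λ k → recip (pow ℂ-rawSemiring (fromℤ k) m + pow ℂ-rawSemiring z m) (d≢0 k))
        U-majorant =
          -- The term at k = 0 is 1/w, which escapes the estimates for K ≥ 1. Any eventual bound
          -- will do, since this term already lies in stage 0 and does not affect `growth`.
          let B₁ , 0<B₁ , M₁ , re₀≤B₁ = eventually-bounded (re (term (+ 0)))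
              B₂ , 0<B₂ , M₂ , im₀≤B₂ = eventually-bounded (im (term (+ 0)))
              M = M₁ ℕ.⊔ M₂
              bound : ℤ → ℚ
              bound = λ { (+ zero) → B₁ ℚ.+ B₂ ; (+ suc j) → A ℚ.* invℚ (powℕ j) ; -[1+ j ] → A ℚ.* invℚ (powℕ j) }
          in record
          { bound    = bound
          ; onset    = N ℕ.⊔ M
          ; re≤bound = λ n l≤n →
              let N≤n = ℕₚ.m⊔n≤o⇒m≤o N M l≤n
                  M₁≤n = ℕₚ.m⊔n≤o⇒m≤o M₁ M₂ (ℕₚ.m⊔n≤o⇒n≤o N M l≤n)
                  nonzero : ∀ k j → ℤ.∣ k ∣ ≡ suc j → ℚ.∣ seq (re (term k)) n ∣ ℚ.≤ A ℚ.* invℚ (powℕ j)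
                  nonzero k j ∣k∣≡ = subst (λ x → ℚ.∣ x ∣ ℚ.≤ A ℚ.* invℚ (powℕ j)) (sym (term-re k ∣k∣≡ n))
                    (invRe-bound (a n) (b n) 0<η (1≤powℕ j) 0≤r r+η≤1 (∣w∣²≤r² n N≤n))
              in λ { (+ zero)  → ℚₚ.≤-trans (re₀≤B₁ n M₁≤n) (≤-by B₂ (ℚₚ.<⇒≤ 0<B₂) refl)
                   ; (+ suc j) → nonzero (+ suc j) j refl
                   ; -[1+ j ]  → nonzero -[1+ j ] j refl }
          ; im≤bound = λ n l≤n →
              let N≤n = ℕₚ.m⊔n≤o⇒m≤o N M l≤n
                  M₂≤n = ℕₚ.m⊔n≤o⇒n≤o M₁ M₂ (ℕₚ.m⊔n≤o⇒n≤o N M l≤n)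
                  nonzero : ∀ k j → ℤ.∣ k ∣ ≡ suc j → ℚ.∣ seq (im (term k)) n ∣ ℚ.≤ A ℚ.* invℚ (powℕ j)
                  nonzero k j ∣k∣≡ = subst (λ x → ℚ.∣ x ∣ ℚ.≤ A ℚ.* invℚ (powℕ j)) (sym (term-im k ∣k∣≡ n))
                    (invIm-bound (a n) (b n) 0<η (1≤powℕ j) 0≤r r+η≤1 (∣w∣²≤r² n N≤n))
              in λ { (+ zero)  → ℚₚ.≤-trans (im₀≤B₂ n M₂≤n) (≤-by B₁ (ℚₚ.<⇒≤ 0<B₁) (ℚₚ.+-comm B₂ B₁))
                   ; (+ suc j) → nonzero (+ suc j) j refl
                   ; -[1+ j ]  → nonzero -[1+ j ] j refl }
          -- Every stage adds two terms, each at most A times twice the gap.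
          ; scale    = 2ℚ ℚ.* 2ℚ ℚ.* A
          ; 0≤scale  = 0≤p*q (ℚₚ.nonNegative⁻¹ (2ℚ ℚ.* 2ℚ)) 0≤A
          ; growth   = λ j →
              let S = ∑ bound (symmetricRange j)
                  c≤ = *-monoʳ-≤ A 0≤A (1/powℕ≤2gap j)
              in subst (∑ bound (symmetricRange (suc j)) ℚ.≤_)
                (solve 3 (λ S g A → A :* (g :+ g) :+ (A :* (g :+ g) :+ S) := S :+ con 2ℚ :* con 2ℚ :* A :* g) refl S (gap j) A)
                (ℚₚ.+-mono-≤ c≤ (ℚₚ.+-monoˡ-≤ S c≤))
          }

        module _ (M : Majorant ℤ-exhaustion (λ k → recip (pow ℂ-rawSemiring (fromℤ k) m + pow ℂ-rawSemiring z m) (d≢0 k))) (w≢0 : NonZero w) (n : ℕ) (N≤n : N ℕ.≤ n) where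

          private
            s = 2ℚ ℚ.* r ℚ.* (invℚ η ℚ.* invℚ η)

            0≤s : 0ℚ ℚ.≤ s
            0≤s = 0≤p*q (0≤p*q (ℚₚ.nonNegative⁻¹ 2ℚ) 0≤r) 0≤i²

            D : ℂ
            D = (Majorant.limit M - recip w w≢0) - (zeta + zeta)

          -- Holds for every majorant `M`, because the approximations of its limit depend on terms
          -- and stages alone; `M` may have been built with constants other than η and r.
          U-close-re : ℚ.∣ seq (re D) n ∣ ℚ.≤ 2ℚ ℚ.* 2ℚ ℚ.* s
          U-close-re = subst (λ x → ℚ.∣ ∑ (λ k → seq (re (term k)) n) (symmetricRange n) ℚ.- x ℚ.-
              (seq (re zeta) n ℚ.+ seq (re zeta) n) ∣ ℚ.≤ 2ℚ ℚ.* 2ℚ ℚ.* s)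
            -- The term at k = 0 and 1/w have equal approximations, so they cancel exactly at each
            -- index.
            (cong₂ invRe (denominator-re-0 n) (denominator-im (+ 0) n))
            (∑-symmetric-close (λ k → seq (re (term k)) n) (λ j → seq (re (zetaTerm j)) n) 0≤s
              (λ k j ∣k∣≡ → subst₂ (λ x y → ℚ.∣ x ℚ.- y ∣ ℚ.≤ s ℚ.* (gap j ℚ.+ gap j))
                (sym (term-re k ∣k∣≡ n)) (sym (zetaTerm-re j n))
                (ℚₚ.≤-trans (invRe-close (a n) (b n) 0<η (1≤powℕ j) 0≤r r+η≤1 (∣w∣²≤r² n N≤n))
                  (*-monoʳ-≤ s 0≤s (1/powℕ≤2gap j))))
              n)

          U-close-im : ℚ.∣ seq (im D) n ∣ ℚ.≤ 2ℚ ℚ.* 2ℚ ℚ.* s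
          U-close-im = subst (λ x → ℚ.∣ ∑ (λ k → seq (im (term k)) n) (symmetricRange n) ℚ.- x ℚ.-
              (seq (im zeta) n ℚ.+ seq (im zeta) n) ∣ ℚ.≤ 2ℚ ℚ.* 2ℚ ℚ.* s)
            (cong₂ invIm (denominator-re-0 n) (denominator-im (+ 0) n))
            (∑-symmetric-close (λ k → seq (im (term k)) n) (λ j → seq (im (zetaTerm j)) n) 0≤s
              (λ k j ∣k∣≡ → subst (λ x → ℚ.∣ x ∣ ℚ.≤ s ℚ.* (gap j ℚ.+ gap j))
                (trans (sym (term-im k ∣k∣≡ n)) (sym (ℚₚ.+-identityʳ (seq (im (term k)) n))))
                (ℚₚ.≤-trans (invIm-close (a n) (b n) 0<η (1≤powℕ j) 0≤r r+η≤1 (∣w∣²≤r² n N≤n))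
                  (*-monoʳ-≤ s 0≤s (1/powℕ≤2gap j))))
              n)

-- The punctured disc and the limit z → 0.

-- From |z|² ≤ 1 - e, the choice r = 1 - e/2 avoids a square root, as r² = 1 - e + e²/4; then η =
-- e/2 fills the rest up to 1.
contraction : ∀ z {m} → 1 ℕ.≤ m → ∣ z ∣< 1ℚ → ∃ λ η → ∃ λ r →
  0ℚ ℚ.< η × 0ℚ ℚ.≤ r × r ℚ.+ η ℚ.≤ 1ℚ × (∃ λ N → ∀ n → N ℕ.≤ n → seq ∣ z ^ m ∣² n ℚ.≤ r ℚ.* r)
contraction z {m} 1≤m (e , 0<e , N , ∣z∣²+e≤1) =
  ½ ℚ.* e , 1ℚ ℚ.- ½ ℚ.* e , 0<p*q (ℚₚ.positive⁻¹ ½) 0<e , p≤q⇒0≤q-p ½e≤1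
  , ℚₚ.≤-reflexive (solve 1 (λ h → (con 1ℚ :- h) :+ h := con 1ℚ) refl (½ ℚ.* e))
  , N , λ n N≤n →
    let ∣z∣² = seq ∣ z ∣² n
        open ℚₚ.≤-Reasoning
    in begin
      seq ∣ z ^ m ∣² n     ≤⟨ ∣^∣²≤∣∣² z n 1≤m (ℚₚ.≤-trans (≤-by e 0≤e refl) (∣z∣²+e≤1 n N≤n)) ⟩
      ∣z∣²                 ≤⟨ ≤-by (1ℚ ℚ.- (∣z∣² ℚ.+ e)) (p≤q⇒0≤q-p (∣z∣²+e≤1 n N≤n))
                                (solve 2 (λ x e → x :+ (con 1ℚ :- (x :+ e)) := con 1ℚ :- e) refl ∣z∣² e) ⟩
      1ℚ ℚ.- e             ≤⟨ ≤-by (½ ℚ.* e ℚ.* (½ ℚ.* e)) (0≤p² (½ ℚ.* e))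
                                (solve 1 (λ e → con 1ℚ :- e :+ con ½ :* e :* (con ½ :* e) :=
                                   (con 1ℚ :- con ½ :* e) :* (con 1ℚ :- con ½ :* e)) refl e) ⟩
      (1ℚ ℚ.- ½ ℚ.* e) ℚ.* (1ℚ ℚ.- ½ ℚ.* e) ∎
  where
  0≤e = ℚₚ.<⇒≤ 0<e
  e≤1 : e ℚ.≤ 1ℚ
  e≤1 = ℚₚ.≤-trans (≤-by (seq ∣ z ∣² N) (0≤∣∣² z N) (ℚₚ.+-comm e (seq ∣ z ∣² N))) (∣z∣²+e≤1 N ℕₚ.≤-refl)
  ½e≤1 : ½ ℚ.* e ℚ.≤ 1ℚ
  ½e≤1 = ℚₚ.≤-trans (≤-by (½ ℚ.* e) (0≤p*q (ℚₚ.nonNegative⁻¹ ½) 0≤e)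
    (solve 1 (λ e → con ½ :* e :+ con ½ :* e := e) refl e)) e≤1

∣^∣²-small : ∀ z {m δ} → 1 ℕ.≤ m → 0ℚ ℚ.≤ δ → δ ℚ.≤ 1ℚ → ∣ z ∣< δ →
  ∃ λ N → ∀ n → N ℕ.≤ n → seq ∣ z ^ m ∣² n ℚ.≤ δ ℚ.* δ
∣^∣²-small z 1≤m 0≤δ δ≤1 (e , 0<e , N , ∣z∣²+e≤δ²) = N , λ n N≤n →
  let ∣z∣²≤δ² = ℚₚ.≤-trans (≤-by e (ℚₚ.<⇒≤ 0<e) refl) (∣z∣²+e≤δ² n N≤n)
  in ℚₚ.≤-trans
       (∣^∣²≤∣∣² z n 1≤m (ℚₚ.≤-trans ∣z∣²≤δ² (*-mono-≤ 0≤δ (ℚₚ.nonNegative⁻¹ 1ℚ) δ≤1 δ≤1)))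
       ∣z∣²≤δ²

common-lower-bound : ∀ {p q} → 0ℚ ℚ.< p → 0ℚ ℚ.< q → ∃ λ δ → 0ℚ ℚ.< δ × δ ℚ.≤ p × δ ℚ.≤ q
common-lower-bound {p} {q} 0<p 0<q with ℚₚ.≤-total p q
... | inj₁ p≤q = p , 0<p , ℚₚ.≤-refl , p≤q
... | inj₂ q≤p = q , 0<q , q≤p , ℚₚ.≤-refl

half-double : ∀ x → x ≃ fromℚ ½ * (x + x)
half-double x =
    (λ ε 0<ε → 0 , λ n _ → vanish 0<ε (re-eq (seq (re x) n) (seq (im x) n)))
  , (λ ε 0<ε → 0 , λ n _ → vanish 0<ε (im-eq (seq (re x) n) (seq (im x) n)))
  where
  vanish : ∀ {d ε} → 0ℚ ℚ.< ε → d ≡ 0ℚ → ℚ.∣ d ∣ ℚ.< ε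
  vanish 0<ε refl = 0<ε
  re-eq : ∀ a b → a ℚ.- (½ ℚ.* (a ℚ.+ a) ℚ.+ ℚ.- (0ℚ ℚ.* (b ℚ.+ b))) ≡ 0ℚ
  re-eq = solve 2 (λ a b → a :- (con ½ :* (a :+ a) :+ :- (con 0ℚ :* (b :+ b))) := con 0ℚ) refl
  im-eq : ∀ a b → b ℚ.- (½ ℚ.* (b ℚ.+ b) ℚ.+ 0ℚ ℚ.* (a ℚ.+ a)) ≡ 0ℚ
  im-eq = solve 2 (λ a b → b :- (con ½ :* (b :+ b) :+ con 0ℚ :* (a :+ a)) := con 0ℚ) refl

1/64 : ℚ
1/64 = + 1 ℚ./ 64

-- The closeness bound 4s with s = 2δ/η² and η = ½ equals 32δ. The factor 1/64 brings it down to
-- ε/2, the size allowed for each component.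
scaled-radius : ∀ {δ ε} → δ ℚ.≤ 1/64 ℚ.* ε →
  2ℚ ℚ.* 2ℚ ℚ.* (2ℚ ℚ.* δ ℚ.* (invℚ ½ ℚ.* invℚ ½)) ℚ.≤ ½ ℚ.* ε
scaled-radius {δ} {ε} δ≤ε/64 = begin
  2ℚ ℚ.* 2ℚ ℚ.* (2ℚ ℚ.* δ ℚ.* (2ℚ ℚ.* 2ℚ))    ≡⟨ solve 1 (λ d →
    con 2ℚ :* con 2ℚ :* (con 2ℚ :* d :* (con 2ℚ :* con 2ℚ)) := con 32ℚ :* d) refl δ ⟩
  32ℚ ℚ.* δ                                   ≤⟨ *-monoʳ-≤ 32ℚ (ℚₚ.nonNegative⁻¹ 32ℚ) δ≤ε/64 ⟩
  32ℚ ℚ.* (1/64 ℚ.* ε)                        ≡⟨ ℚₚ.*-assoc 32ℚ 1/64 ε ⟨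
  ½ ℚ.* ε                                     ∎
  where
  open ℚₚ.≤-Reasoning
  32ℚ = + 32 ℚ./ 1

module _ (m : ℕ) (2≤m : 2 ℕ.≤ m) (even : ∀ x → (ℚ.- x) ^ℚ m ≡ x ^ℚ m) where

  private
    1≤m : 1 ℕ.≤ m
    1≤m = ℕₚ.≤-trans (ℕ.s≤s ℕ.z≤n) 2≤m

    ζ : ℂ
    ζ = zeta m 2≤m

  denominators : ∀ z → PuncturedDisc z → ∀ k → NonZero (pow ℂ-rawSemiring (fromℤ k) m + pow ℂ-rawSemiring z m)
  denominators z (z≢0 , ∣z∣<1) =
    let η , r , 0<η , 0≤r , r+η≤1 , N , bound = contraction z 1≤m ∣z∣<1
    in denominator-nonZero m 2≤m even z 0<η 0≤r r+η≤1 bound (^-nonZero z z≢0 m)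

  majorant : ∀ z p → Majorant ℤ-exhaustion (λ k → recip (pow ℂ-rawSemiring (fromℤ k) m + pow ℂ-rawSemiring z m) (denominators z p k))
  majorant z p@(_ , ∣z∣<1) =
    let η , r , 0<η , 0≤r , r+η≤1 , N , bound = contraction z 1≤m ∣z∣<1
    in U-majorant m 2≤m even z (denominators z p) 0<η 0≤r r+η≤1 bound

  U : ∀ z → PuncturedDisc z → ℂ
  U z p = Majorant.limit (majorant z p)

  -- With r = δ and η = ½ the estimate is uniform in z, although `U z p` was constructed with
  -- constants that depend on z.
  close : ∀ {δ ε} → 0ℚ ℚ.< ε → 0ℚ ℚ.< δ → δ ℚ.≤ ½ → δ ℚ.≤ 1/64 ℚ.* ε → ∀ z (p : PuncturedDisc z) →
    ∣ z ∣< δ → ∣ (U z p - recip (z ^ m) (^-nonZero z (proj₁ p) m)) - (ζ + ζ) ∣< ε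
  close {δ} {ε} 0<ε 0<δ δ≤½ δ≤ε/64 z p ∣z∣<δ =
    ∣∣<-intro ((U z p - recip (z ^ m) w≢0) - (ζ + ζ)) 0<ε (proj₁ bounded , λ i N≤i →
        ℚₚ.≤-trans (U-close-re m 2≤m even z (denominators z p) (ℚₚ.positive⁻¹ ½) 0≤δ δ+½≤1
          (proj₂ bounded) (majorant z p) w≢0 i N≤i) (scaled-radius {δ} {ε} δ≤ε/64)
      , ℚₚ.≤-trans (U-close-im m 2≤m even z (denominators z p) (ℚₚ.positive⁻¹ ½) 0≤δ δ+½≤1
          (proj₂ bounded) (majorant z p) w≢0 i N≤i) (scaled-radius {δ} {ε} δ≤ε/64))
    where
    w≢0 = ^-nonZero z (proj₁ p) m
    0≤δ = ℚₚ.<⇒≤ 0<δ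
    δ+½≤1 = ℚₚ.+-monoˡ-≤ ½ δ≤½
    bounded = ∣^∣²-small z 1≤m 0≤δ (ℚₚ.≤-trans δ≤½ (≤-by ½ (ℚₚ.nonNegative⁻¹ ½) refl)) ∣z∣<δ

  converges : (λ z p → U z p - recip (z ^ m) (^-nonZero z (proj₁ p) m)) ⟶₀ (ζ + ζ)
  converges ε 0<ε =
    let δ , 0<δ , δ≤½ , δ≤ε/64 = common-lower-bound (ℚₚ.positive⁻¹ ½) (0<p*q (ℚₚ.positive⁻¹ 1/64) 0<ε)
    in δ , 0<δ , close 0<ε 0<δ δ≤½ δ≤ε/64

  zeta-as-limit : ∃ λ (ζₘ : ℂ) → IsZeta m ζₘ ×
    (∃ λ (Uₘ : ∀ z → PuncturedDisc z → ℂ) → (∀ z p → IsU m z (Uₘ z p)) ×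
    (∃ λ (ℓ : ℂ) →
    ((λ z p → Uₘ z p - recip (z ^ m) (^-nonZero z (proj₁ p) m)) ⟶₀ ℓ) ×
    ζₘ ≃ fromℚ ½ * ℓ))
  zeta-as-limit =
      ζ , Majorant.hasSum (zeta-majorant m 2≤m)
    , U , (λ z p → denominators z p , Majorant.hasSum (majorant z p))
    , ζ + ζ , converges , half-double ζ

corollary2p4 : ∀ (n : ℕ) → 1 ℕ.≤ n →
    ∃ λ (ζ₂ₙ : ℂ) → IsZeta (2 ℕ.* n) ζ₂ₙ ×
    (∃ λ (U₂ₙ : ∀ z → PuncturedDisc z → ℂ) → (∀ z p → IsU (2 ℕ.* n) z (U₂ₙ z p)) ×
    (∃ λ (ℓ : ℂ) →
    ((λ z p → U₂ₙ z p - recip (z ^ (2 ℕ.* n)) (^-nonZero z (proj₁ p) (2 ℕ.* n))) ⟶₀ ℓ) ×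
    ζ₂ₙ ≃ fromℚ ½ * ℓ))
corollary2p4 n 1≤n = zeta-as-limit (2 ℕ.* n) (ℕₚ.*-monoʳ-≤ 2 1≤n) (λ x → even-^ℚ x n)
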